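{- Every fan graph $F_n$ ($n\ge 2$) satisfies $sn(F_n)=2$, and every maximal outerplanar graph $G$ of order at least $3$ satisfies $sn(G)=2$.
   Context: Graphs are finite, undirected and simple. The fan graph $F_n$, $n\ge 2$, is obtained from a path $P_n=v_1v_2\cdots v_n$ by joining a new vertex $u$ to every vertex of $P_n$. A maximal outerplanar graph is an outerplanar graph to which no edge between nonadjacent vertices can be added while preserving outerplanarity. Let $G=(V,E)$ be a connected graph with chromatic number $\chi(G)=k\ge 2$. For $S\subset V$, a partial coloring on $G[S]$ is a proper coloring $\mathscr C_0$ of the induced subgraph $G[S]$ with colors from $\{1,\dots,k\}$ (not all colors need be used). It is a Sudoku coloring of $G$ if there is exactly one proper $k$-coloring $V\to\{1,\dots,k\}$ of $G$ whose restriction to $S$ is $\mathscr C_0$. The Sudoku number $sn(G)$ is the smallest $|S|$ such that $G[S]$ admits a Sudoku coloring of $G$.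
   Formalization: Outerplanarity is defined by plane drawings with polygonal edges whose vertices and bends have rational rather than real coordinates; a small perturbation of the corners shows that the same graphs are outerplanar. -}

module Defs where

open import Data.Empty using (⊥; ⊥-elim)
open import Data.Fin using (Fin; zero; suc; toℕ)
import Data.Fin.Properties as Fin
open import Data.Fin.Subset using (Subset; _∈_; ∣_∣)
open import Data.List using (List; []; _∷_; _++_; reverse)
open import Data.Nat using (ℕ; zero; suc; _≤_)
import Data.Nat.Properties as ℕ
open import Data.Product using (Σ; ∃; ∃-syntax; _×_; _,_; proj₁; proj₂)
open import Data.Rational using (ℚ; 0ℚ; 1ℚ)
import Data.Rational as ℚ
open import Data.Sum using (_⊎_; inj₁; inj₂; swap)
open import Data.Unit using (⊤; tt)
open import Level using (0ℓ)
open import Relation.Binary using (Rel; Decidable; Symmetric)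
open import Relation.Binary.Construct.Closure.ReflexiveTransitive using (Star)
open import Relation.Binary.PropositionalEquality
  using (_≡_; _≢_; refl; sym; trans)
open import Relation.Nullary using (¬_; yes; no)
open import Relation.Nullary.Decidable using (_×-dec_; _⊎-dec_)

record Graph (n : ℕ) : Set₁ where
  infix 4 _~_ _~?_
  field
    _~_      : Rel (Fin n) 0ℓ
    _~?_     : Decidable _~_
    ~-sym    : Symmetric _~_
    ~-irrefl : ∀ {v} → ¬ (v ~ v)

Connected : ∀ {n} → Graph n → Set
Connected G = ∀ u v → Star (Graph._~_ G) u v

path : ∀ n → Graph n
path n = record
  { _~_      = λ i j → suc (toℕ i) ≡ toℕ j ⊎ suc (toℕ j) ≡ toℕ i
  ; _~?_     = λ i j → (suc (toℕ i) ℕ.≟ toℕ j) ⊎-dec (suc (toℕ j) ℕ.≟ toℕ i)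
  ; ~-sym    = swap
  ; ~-irrefl = λ { (inj₁ e) → ℕ.1+n≢n e ; (inj₂ e) → ℕ.1+n≢n e }
  }

-- The new vertex is zero; the old vertex i becomes suc i.
cone : ∀ {n} → Graph n → Graph (suc n)
cone {n} G = record
  { _~_      = adj
  ; _~?_     = adj?
  ; ~-sym    = λ {u} {v} → adj-sym u v
  ; ~-irrefl = λ {v} → adj-irrefl v
  }
  where
  open Graph G

  adj : Rel (Fin (suc n)) 0ℓ
  adj zero    zero    = ⊥
  adj zero    (suc _) = ⊤
  adj (suc _) zero    = ⊤
  adj (suc i) (suc j) = i ~ j

  adj? : Decidable adj
  adj? zero    zero    = no λ ()
  adj? zero    (suc _) = yes tt
  adj? (suc _) zero    = yes tt
  adj? (suc i) (suc j) = i ~? j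

  adj-sym : ∀ u v → adj u v → adj v u
  adj-sym zero    (suc _) _ = tt
  adj-sym (suc _) zero    _ = tt
  adj-sym (suc i) (suc j) e = ~-sym e

  adj-irrefl : ∀ v → ¬ adj v v
  adj-irrefl (suc i) e = ~-irrefl e

fan : ∀ n → Graph (suc n)
fan n = cone (path n)

SameEdge : ∀ {n} → Fin n → Fin n → Fin n → Fin n → Set
SameEdge u v x y = (u ≡ x × v ≡ y) ⊎ (u ≡ y × v ≡ x)

addEdge : ∀ {n} → Graph n → (u v : Fin n) → u ≢ v → Graph n
addEdge G u v u≢v = record
  { _~_      = λ x y → x ~ y ⊎ SameEdge x y u v
  ; _~?_     = λ x y → (x ~? y) ⊎-dec
                 (((x Fin.≟ u) ×-dec (y Fin.≟ v)) ⊎-dec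
                  ((x Fin.≟ v) ×-dec (y Fin.≟ u)))
  ; ~-sym    = λ { (inj₁ e)              → inj₁ (~-sym e)
                 ; (inj₂ (inj₁ (p , q))) → inj₂ (inj₂ (q , p))
                 ; (inj₂ (inj₂ (p , q))) → inj₂ (inj₁ (q , p)) }
  ; ~-irrefl = λ { (inj₁ e)              → ~-irrefl e
                 ; (inj₂ (inj₁ (p , q))) → u≢v (trans (sym p) q)
                 ; (inj₂ (inj₂ (p , q))) → u≢v (trans (sym q) p) }
  }
  where open Graph G

-- In plane drawings, edges are drawn as polygonal arcs.  All vertices and bends have rational
-- coordinates; this admits the same graphs as drawings in the real plane,
-- because a polygonal drawing can be perturbed to a rational one, and
-- two segments with rational ends that meet do so in a rational point.

Point : Set
Point = ℚ × ℚ

_between_ : Point → Point × Point → Set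
(x , y) between ((x₁ , y₁) , (x₂ , y₂)) = ∃[ t ]
  0ℚ ℚ.≤ t × t ℚ.≤ 1ℚ ×
  x ≡ (1ℚ ℚ.- t) ℚ.* x₁ ℚ.+ t ℚ.* x₂ ×
  y ≡ (1ℚ ℚ.- t) ℚ.* y₁ ℚ.+ t ℚ.* y₂

-- A polygonal curve is given by the list of its successive corners,
-- end points included.
OnCurve : List Point → Point → Set
OnCurve []           p = ⊥
OnCurve (a ∷ [])     p = p ≡ a
OnCurve (a ∷ b ∷ ps) p = p between (a , b) ⊎ OnCurve (b ∷ ps) p

-- The curve does not meet itself, i.e. it is an arc: each segment meets
-- the rest of the curve only in the corner at which the rest starts.
IsArc : List Point → Set
IsArc []           = ⊤
IsArc (a ∷ [])     = ⊤
IsArc (a ∷ b ∷ ps) =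
  (∀ p → p between (a , b) → OnCurve (b ∷ ps) p → p ≡ b) × IsArc (b ∷ ps)

record PlaneDrawing {n} (G : Graph n) : Set where
  open Graph G
  field
    pos   : Fin n → Point
    -- Only the values at adjacent pairs matter.
    bends : Fin n → Fin n → List Point

  curve : Fin n → Fin n → List Point
  curve u v = pos u ∷ bends u v ++ pos v ∷ []

  field
    pos-injective : ∀ u v → pos u ≡ pos v → u ≡ v
    -- u ~ v and v ~ u are the same edge, traversed in opposite directions.
    bends-sym     : ∀ u v → u ~ v → bends v u ≡ reverse (bends u v)
    curve-arc     : ∀ u v → u ~ v → IsArc (curve u v)
    -- The interior of an edge contains no vertex ...
    vertex-free   : ∀ u v w → u ~ v → OnCurve (curve u v) (pos w) →
                    w ≡ u ⊎ w ≡ v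
    -- ... and no point of another edge.
    edges-cross-free : ∀ u v x y → u ~ v → x ~ y → ¬ SameEdge u v x y →
                       ∀ p → OnCurve (curve u v) p → OnCurve (curve x y) p →
                       ∃[ w ] p ≡ pos w

  Drawn : Point → Set
  Drawn p = (∃[ w ] p ≡ pos w) ⊎
            (∃[ u ] ∃[ v ] (u ~ v × OnCurve (curve u v) p))

  -- To the right of the whole drawing, hence in the unbounded face.
  Beyond : Point → Set
  Beyond z = ∀ p → Drawn p → proj₁ p ℚ.< proj₁ z

  -- A vertex is on the boundary of the unbounded face iff a polygonal curve
  -- leads from it into that face without meeting the drawing elsewhere.
  OnOuterFace : Fin n → Set
  OnOuterFace v = ∃[ z ] ∃[ ps ]
    (Beyond z × (∀ p → OnCurve (pos v ∷ ps ++ z ∷ []) p → Drawn p → p ≡ pos v))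

Outerplanar : ∀ {n} → Graph n → Set
Outerplanar G = Σ (PlaneDrawing G) λ D → ∀ v → PlaneDrawing.OnOuterFace D v

MaximalOuterplanar : ∀ {n} → Graph n → Set
MaximalOuterplanar G =
  Outerplanar G ×
  (∀ u v (u≢v : u ≢ v) → ¬ (Graph._~_ G u v) → ¬ Outerplanar (addEdge G u v u≢v))

module _ {n} (G : Graph n) where
  open Graph G

  IsProper : ∀ {k} → (Fin n → Fin k) → Set
  IsProper c = ∀ u v → u ~ v → c u ≢ c v

  Colorable : ℕ → Set
  Colorable k = Σ (Fin n → Fin k) IsProper

  IsChromaticNumber : ℕ → Set
  IsChromaticNumber k = Colorable k × (∀ j → Colorable j → k ≤ j)

  record PartialColoring (k : ℕ) (S : Subset n) : Set where
    field
      color  : ∀ v → v ∈ S → Fin k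
      proper : ∀ u v (u∈S : u ∈ S) (v∈S : v ∈ S) → u ~ v →
               color u u∈S ≢ color v v∈S

  module _ {k : ℕ} {S : Subset n} (C₀ : PartialColoring k S) where
    open PartialColoring C₀

    IsExtension : (Fin n → Fin k) → Set
    IsExtension c = IsProper c × (∀ v (v∈S : v ∈ S) → c v ≡ color v v∈S)

    IsSudokuColoring : Set
    IsSudokuColoring = ∃[ c ] (IsExtension c × (∀ c′ → IsExtension c′ → ∀ v → c′ v ≡ c v))

  AdmitsSudokuColoring : ℕ → Subset n → Set
  AdmitsSudokuColoring k S = Σ (PartialColoring k S) IsSudokuColoring

  -- sn(G) = s.  The Sudoku number is defined only for connected graphs of
  -- chromatic number at least 2, so both are part of the assertion.
  record HasSudokuNumber (s : ℕ) : Set where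
    field
      connected : Connected G
      χ         : ℕ
      χ-correct : IsChromaticNumber χ
      χ≥2       : 2 ≤ χ
      attained  : ∃[ S ] (∣ S ∣ ≡ s × AdmitsSudokuColoring χ S)
      minimal   : ∀ S → AdmitsSudokuColoring χ S → s ≤ ∣ S ∣

{-# OPTIONS --safe #-}

-- Compare points of ℚ² lexicographically and count, mod 2, how often a
-- curve P passes above a point x.  For disjoint curves P from p to p′ and Q
-- from q to q′, the four counts of P above q, q′ and of Q above p, p′ add up
-- to a quantity that depends only on the order of the end points.  Applied to
-- the edges of an outerplanar drawing and to the curves that lead from the
-- vertices into the outer face, this produces a tournament σ on the vertices
-- such that σ(a,c) + σ(a,d) + σ(b,c) + σ(b,d) = 0 for all disjoint edges ab
-- and cd.  If σ were transitive, this would say that ab and cd do not cross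
-- when the vertices are placed on a line in the order σ and the edges are
-- drawn on one side of it.  In general σ can be replaced by a linear order
-- with this property, by cutting the graph along an edge or between
-- components.  Conversely a noncrossing order gives a drawing with vertices
-- on a parabola and straight edges.  Hence in a maximal outerplanar graph any
-- two vertices that can be joined without a crossing are adjacent, so the
-- graph is a triangulated polygon, and its 3-colourings are determined by
-- the colours of the first and the last vertex.  A fan has the same property.
module Submission where

open import Data.Bool using (Bool; true; false; _∧_; _xor_; not)
import Data.Bool.Properties as 𝔹
open import Data.Bool.Solver using (module xor-∧-Solver)
open import Data.Empty using (⊥; ⊥-elim)
open import Data.Fin using (Fin; zero; suc; toℕ; fromℕ<)
import Data.Fin.Properties as Fin
open import Data.Fin.Subset using (Subset; ⁅_⁆; _∪_; ∣_∣) renaming (_∈_ to _∈ˢ_)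
import Data.Fin.Subset.Properties as Subset
open import Data.List using (List; []; _∷_; _++_; length; filter; allFin)
import Data.List.Membership.DecPropositional as DecMembership
open import Data.List.Membership.Propositional using (_∈_; find; lose)
open import Data.List.Membership.Propositional.Properties using (∈-filter⁺; ∈-filter⁻; ∈-allFin)
import Data.List.Properties as List
open import Data.List.Relation.Unary.Any using (Any; here; there; any?)
open import Data.Nat as ℕ using (ℕ; zero; suc; _≤_; s≤s; z≤n)
import Data.Nat.Properties as ℕ
open import Data.Product using (∃; ∃-syntax; _×_; _,_; proj₁; proj₂)
open import Data.Rational using (ℚ; 0ℚ; 1ℚ; positive; nonNegative)
import Data.Rational.Properties as ℚ
open import Data.Sum using (_⊎_; inj₁; inj₂; [_,_]′)
import Data.Sum as Sum
open import Data.Unit using (⊤; tt)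
open import Defs
open import Function using (_∘_; id)
open import Level using (0ℓ)
open import Relation.Binary using (Tri; tri<; tri≈; tri>)
open import Relation.Binary.Construct.Closure.ReflexiveTransitive using (Star; ε; _◅_; _◅◅_; reverse)
open import Relation.Binary.PropositionalEquality
open import Relation.Nullary using (¬_; Dec; yes; no; does; contradiction)
open import Relation.Nullary.Decidable
  using (_×-dec_; _→-dec_; ¬?; from-yes; decidable-stable; dec⇒maybe; dec-true; dec-false)
open import Relation.Unary using (Pred; Decidable)
open import Tactic.RingSolver using (solve-∀)
open import Tactic.RingSolver.Core.AlmostCommutativeRing using (AlmostCommutativeRing; fromCommutativeRing)

-- Additivity over concatenation takes the place of the Jordan curve theorem: the parity identity
-- has to be checked only for two disjoint segments. The exits of different vertices may meet each
-- other, so they do not order the vertices. What is controlled is the exit of c against the edges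
-- that avoid c, and only modulo 2. Hence nothing forces σ to be transitive; for a graph without
-- edges, every tournament satisfies the crossing condition. Passing to a linear order is an
-- induction on vertex sets. Once the graph is cut at a vertex, each side must still keep the edges
-- at that vertex uncrossed. So the induction statement carries two imaginary vertices, a first and
-- a last one, which survive only as the predicates `P` and `Q`. A failure of transitivity among the
-- neighbours of the first one exhibits a union of components that can be moved to the front.

module CurveParity where

  open import Data.Rational using (_+_; _*_; _-_; -_; _<_; 1/_) renaming (_≤_ to _≤ℚ_)

  -- Signs and the lexicographic order of the rational plane.

  ringℚ : AlmostCommutativeRing _ _
  ringℚ = fromCommutativeRing ℚ.+-*-commutativeRing (λ x → dec⇒maybe (0ℚ ℚ.≟ x))

  0≤*  : ∀ {x y} → 0ℚ ≤ℚ x → 0ℚ ≤ℚ y → 0ℚ ≤ℚ x * y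
  0≤* {x} {y} 0≤x 0≤y = subst (_≤ℚ x * y) (ℚ.*-zeroʳ x) (ℚ.*-monoˡ-≤-nonNeg x {{nonNegative 0≤x}} 0≤y)

  0<* : ∀ {x y} → 0ℚ < x → 0ℚ < y → 0ℚ < x * y
  0<* {x} {y} 0<x 0<y = subst (_< x * y) (ℚ.*-zeroʳ x) (ℚ.*-monoʳ-<-pos x {{positive 0<x}} 0<y)

  0<- : ∀ {x y} → x < y → 0ℚ < y - x
  0<- {x} {y} x<y = subst (_< y - x) (ℚ.+-inverseʳ x) (ℚ.+-monoˡ-< (- x) x<y)

  0≤- : ∀ {x y} → x ≤ℚ y → 0ℚ ≤ℚ y - x
  0≤- {x} {y} x≤y = subst (_≤ℚ y - x) (ℚ.+-inverseʳ x) (ℚ.+-monoˡ-≤ (- x) x≤y)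

  <⇒0<neg : ∀ {x} → x < 0ℚ → 0ℚ < - x
  <⇒0<neg = ℚ.neg-antimono-<

  LexPositive LexNonNegative : ℚ → ℚ → Set
  LexPositive x y = 0ℚ < x ⊎ (0ℚ ≡ x × 0ℚ < y)
  LexNonNegative x y = 0ℚ < x ⊎ (0ℚ ≡ x × 0ℚ ≤ℚ y)

  LexPositive-+ : ∀ {x y x′ y′} → LexPositive x y → LexNonNegative x′ y′ → LexPositive (x + x′) (y + y′)
  LexPositive-+ (inj₁ 0<x)          (inj₁ 0<x′)          = inj₁ (ℚ.+-mono-< 0<x 0<x′)
  LexPositive-+ (inj₁ 0<x)          (inj₂ (refl , _))    = inj₁ (ℚ.+-mono-<-≤ 0<x ℚ.≤-refl)
  LexPositive-+ (inj₂ (refl , _))   (inj₁ 0<x′)          = inj₁ (ℚ.+-mono-≤-< ℚ.≤-refl 0<x′)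
  LexPositive-+ (inj₂ (refl , 0<y)) (inj₂ (refl , 0≤y′)) = inj₂ (refl , ℚ.+-mono-<-≤ 0<y 0≤y′)

  LexPositive-* : ∀ {w x y} → 0ℚ < w → LexPositive x y → LexPositive (w * x) (w * y)
  LexPositive-* 0<w (inj₁ 0<x)          = inj₁ (0<* 0<w 0<x)
  LexPositive-* {w} 0<w (inj₂ (refl , 0<y)) = inj₂ (sym (ℚ.*-zeroʳ w) , 0<* 0<w 0<y)

  LexNonNegative-* : ∀ {w x y} → 0ℚ ≤ℚ w → LexPositive x y → LexNonNegative (w * x) (w * y)
  LexNonNegative-* {w} {x} {y} 0≤w v with ℚ.<-cmp 0ℚ w
  ... | tri< 0<w _ _ with LexPositive-* {w} {x} {y} 0<w v
  ...   | inj₁ p       = inj₁ p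
  ...   | inj₂ (e , p) = inj₂ (e , ℚ.<⇒≤ p)
  LexNonNegative-* {w} {x} {y} 0≤w v | tri≈ _ refl _ = inj₂ (sym (ℚ.*-zeroˡ x) , ℚ.≤-reflexive (sym (ℚ.*-zeroˡ y)))
  LexNonNegative-* 0≤w v | tri> _ _ w<0 = ⊥-elim (ℚ.<-irrefl refl (ℚ.<-≤-trans w<0 0≤w))

  -- The lexicographically positive vectors form a convex cone that omits zero. This refutes a
  -- vanishing Abel sum whose coefficients are all nonnegative and not all zero.
  positive-combination≢0 : ∀ {u v w x₁ y₁ x₂ y₂ x₃ y₃} →
    0ℚ < u → 0ℚ ≤ℚ v → 0ℚ ≤ℚ w → LexPositive x₁ y₁ → LexPositive x₂ y₂ → LexPositive x₃ y₃ →
    u * x₁ + v * x₂ + w * x₃ ≡ 0ℚ → u * y₁ + v * y₂ + w * y₃ ≡ 0ℚ → ⊥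
  positive-combination≢0 {x₁ = x₁} {y₁} {x₂} {y₂} {x₃} {y₃} 0<u 0≤v 0≤w d₁ d₂ d₃ ex ey
    with LexPositive-+ (LexPositive-+ (LexPositive-* {x = x₁} {y₁} 0<u d₁) (LexNonNegative-* {x = x₂} {y₂} 0≤v d₂)) (LexNonNegative-* {x = x₃} {y₃} 0≤w d₃)
  ... | inj₁ p       = ℚ.<-irrefl (sym ex) p
  ... | inj₂ (_ , p) = ℚ.<-irrefl (sym ey) p

  infix 4 _≺_ _≺?_

  -- This order is that of the first coordinate after an infinitesimal shear. Distinct points are
  -- always comparable, so no segment with distinct ends counts as vertical and no general position
  -- has to be arranged.
  data _≺_ : Point → Point → Set where
    first<  : ∀ {x y x′ y′} → x < x′ → (x , y) ≺ (x′ , y′)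
    second< : ∀ {x y y′} → y < y′ → (x , y) ≺ (x , y′)

  ≺-irrefl : ∀ {a} → ¬ (a ≺ a)
  ≺-irrefl (first< p)  = ℚ.<-irrefl refl p
  ≺-irrefl (second< p) = ℚ.<-irrefl refl p

  ≺-trans : ∀ {a b c} → a ≺ b → b ≺ c → a ≺ c
  ≺-trans (first< p)  (first< q)  = first< (ℚ.<-trans p q)
  ≺-trans (first< p)  (second< _) = first< p
  ≺-trans (second< _) (first< q)  = first< q
  ≺-trans (second< p) (second< q) = second< (ℚ.<-trans p q)

  ≺-asym : ∀ {a b} → a ≺ b → ¬ (b ≺ a)
  ≺-asym p q = ≺-irrefl (≺-trans p q)

  opaque
    ≺-cmp : ∀ a b → Tri (a ≺ b) (a ≡ b) (b ≺ a)
    ≺-cmp (x , y) (x′ , y′) with ℚ.<-cmp x x′ | ℚ.<-cmp y y′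
    ... | tri< p x≢ _ | _ = tri< (first< p) (λ { refl → x≢ refl }) (≺-asym (first< p))
    ... | tri> _ x≢ p | _ = tri> (≺-asym (first< p)) (λ { refl → x≢ refl }) (first< p)
    ... | tri≈ _ refl _ | tri< q y≢ _ = tri< (second< q) (λ { refl → y≢ refl }) (≺-asym (second< q))
    ... | tri≈ _ refl _ | tri> _ y≢ q = tri> (≺-asym (second< q)) (λ { refl → y≢ refl }) (second< q)
    ... | tri≈ _ refl _ | tri≈ _ refl _ = tri≈ ≺-irrefl refl ≺-irrefl

    _≺?_ : ∀ a b → Dec (a ≺ b)
    a ≺? b with ≺-cmp a b
    ... | tri< p _ _ = yes p
    ... | tri≈ n _ _ = no n
    ... | tri> n _ _ = no n

  ≺⇒LexPositive : ∀ {a b} → a ≺ b → LexPositive (proj₁ b - proj₁ a) (proj₂ b - proj₂ a)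
  ≺⇒LexPositive (first< p)          = inj₁ (0<- p)
  ≺⇒LexPositive (second< {x = x} q) = inj₂ (sym (ℚ.+-inverseʳ x) , 0<- q)

  -- Convex combinations, affine dependencies and meeting segments.

  between-weighted : ∀ {p a b} u v → 0ℚ ≤ℚ u → 0ℚ ≤ℚ v → 0ℚ < u + v →
    (u + v) * proj₁ p ≡ u * proj₁ a + v * proj₁ b →
    (u + v) * proj₂ p ≡ u * proj₂ a + v * proj₂ b → p between (a , b)
  between-weighted {px , py} {ax , ay} {bx , by} u v 0≤u 0≤v 0<d ex ey =
    v * i , 0≤* 0≤v (ℚ.<⇒≤ 0<i) , t≤1 , coord ax bx px ex , coord ay by py ey
    where
    d = u + v
    instance
      d-positive = positive 0<d
      d-nonZero = ℚ.pos⇒nonZero d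
    i = 1/ d
    id≡1 : i * d ≡ 1ℚ
    id≡1 = ℚ.*-inverseˡ d
    0<i : 0ℚ < i
    0<i = ℚ.positive⁻¹ i {{ℚ.1/pos⇒pos d}}
    split : ∀ u v i → i * (u + v) - v * i ≡ u * i
    split = solve-∀ ringℚ
    1-t : 1ℚ - v * i ≡ u * i
    1-t = trans (cong (_- v * i) (sym id≡1)) (split u v i)
    t≤1 : v * i ≤ℚ 1ℚ
    t≤1 = subst₂ _≤ℚ_ (ℚ.+-identityˡ (v * i)) (back 1ℚ (v * i))
            (ℚ.+-monoˡ-≤ (v * i) (subst (0ℚ ≤ℚ_) (sym 1-t) (0≤* 0≤u (ℚ.<⇒≤ 0<i))))
      where back : ∀ x y → x - y + y ≡ x
            back = solve-∀ ringℚ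
    dist : ∀ u v i a b → i * (u * a + v * b) ≡ u * i * a + v * i * b
    dist = solve-∀ ringℚ
    coord : ∀ a b p → d * p ≡ u * a + v * b → p ≡ (1ℚ - v * i) * a + v * i * b
    coord a b p e = begin
      p                             ≡⟨ sym (ℚ.*-identityˡ p) ⟩
      1ℚ * p                        ≡⟨ cong (_* p) (sym id≡1) ⟩
      i * d * p                     ≡⟨ ℚ.*-assoc i d p ⟩
      i * (d * p)                   ≡⟨ cong (i *_) e ⟩
      i * (u * a + v * b)           ≡⟨ dist u v i a b ⟩
      u * i * a + v * i * b         ≡⟨ cong (λ s → s * a + v * i * b) (sym 1-t) ⟩
      (1ℚ - v * i) * a + v * i * b  ∎
      where open ≡-Reasoning

  opaque
    -- Twice the signed area of the triangle abp, positive if p lies to the left of the line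
    -- directed from a to b. For a ≺ b, left means above in the sheared plane.
    det : Point → Point → Point → ℚ
    det (ax , ay) (bx , by) (px , py) = (bx - ax) * (py - ay) - (by - ay) * (px - ax)

  opaque
    unfolding det

    -- The weights are differences of first coordinates, or of second coordinates when all three
    -- points lie on one vertical line.
    collinear-between : ∀ {a b p} → a ≺ p → p ≺ b → det a b p ≡ 0ℚ → p between (a , b)
    collinear-between {ax , ay} {bx , by} {px , py} a≺p p≺b e = go a≺p p≺b
      where
      collect : ∀ u v x → (u + v) * x ≡ u * x + v * x
      collect = solve-∀ ringℚ
      tele : ∀ a p b → b - a ≡ b - p + (p - a)
      tele = solve-∀ ringℚ
      self : ∀ a p b → (b - p + (p - a)) * p ≡ (b - p) * a + (p - a) * b
      self = solve-∀ ringℚ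
      area : ∀ ax ay bx by px py → (bx - px + (px - ax)) * py ≡
             (bx - px) * ay + (px - ax) * by + ((bx - ax) * (py - ay) - (by - ay) * (px - ax))
      area = solve-∀ ringℚ
      slanted : ax ≤ℚ px → px ≤ℚ bx → ax < bx → (px , py) between ((ax , ay) , (bx , by))
      slanted l r s = between-weighted (bx - px) (px - ax) (0≤- r) (0≤- l)
        (subst (0ℚ <_) (tele ax px bx) (0<- s)) (self ax px bx)
        (trans (area ax ay bx by px py)
          (trans (cong ((bx - px) * ay + (px - ax) * by +_) e) (ℚ.+-identityʳ _)))
      go : (ax , ay) ≺ (px , py) → (px , py) ≺ (bx , by) → (px , py) between ((ax , ay) , (bx , by))
      go (first< p) (first< q) = slanted (ℚ.<⇒≤ p) (ℚ.<⇒≤ q) (ℚ.<-trans p q)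
      go (first< p) (second< _) = slanted (ℚ.<⇒≤ p) ℚ.≤-refl p
      go (second< _) (first< q) = slanted ℚ.≤-refl (ℚ.<⇒≤ q) q
      go (second< p) (second< q) =
        between-weighted (by - py) (py - ay) (ℚ.<⇒≤ (0<- q)) (ℚ.<⇒≤ (0<- p))
          (subst (0ℚ <_) (tele ay py by) (0<- (ℚ.<-trans p q)))
          (collect (by - py) (py - ay) ax) (self ay py by)

  record AffineDependency (a b p q : Point) (wa wb wp wq : ℚ) : Set where
    constructor dependency
    field
      weights : wa + wb + wp + wq ≡ 0ℚ
      first   : wa * proj₁ a + wb * proj₁ b + wp * proj₁ p + wq * proj₁ q ≡ 0ℚ
      second  : wa * proj₂ a + wb * proj₂ b + wp * proj₂ p + wq * proj₂ q ≡ 0ℚ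

  neg-dependency : ∀ {a b p q wa wb wp wq} → AffineDependency a b p q wa wb wp wq →
                   AffineDependency a b p q (- wa) (- wb) (- wp) (- wq)
  neg-dependency {ax , ay} {bx , by} {px , py} {qx , qy} {wa} {wb} {wp} {wq} (dependency e ex ey) =
    dependency (trans (flip₀ wa wb wp wq) (cong -_ e))
               (trans (flip₁ wa wb wp wq ax bx px qx) (cong -_ ex))
               (trans (flip₁ wa wb wp wq ay by py qy) (cong -_ ey))
    where
    flip₀ : ∀ a b c d → - a + - b + - c + - d ≡ - (a + b + c + d)
    flip₀ = solve-∀ ringℚ
    flip₁ : ∀ a b c d x y z w → - a * x + - b * y + - c * z + - d * w ≡ - (a * x + b * y + c * z + d * w)
    flip₁ = solve-∀ ringℚ

  opaque
    unfolding det

    -- Cramer's rule: up to sign, the weight of each point is the area of the triangle on the other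
    -- three.
    det-dependency : ∀ a b p q → AffineDependency a b p q (det p q b) (- det p q a) (det a b q) (- det a b p)
    det-dependency (ax , ay) (bx , by) (px , py) (qx , qy) = dependency
      (l₀ ax ay bx by px py qx qy) (l₁ ax ay bx by px py qx qy) (l₂ ax ay bx by px py qx qy)
      where
      l₀ : ∀ ax ay bx by px py qx qy →
           (qx - px) * (by - py) - (qy - py) * (bx - px) + - ((qx - px) * (ay - py) - (qy - py) * (ax - px)) +
           ((bx - ax) * (qy - ay) - (by - ay) * (qx - ax)) + - ((bx - ax) * (py - ay) - (by - ay) * (px - ax)) ≡ 0ℚ
      l₀ = solve-∀ ringℚ
      l₁ : ∀ ax ay bx by px py qx qy →
           ((qx - px) * (by - py) - (qy - py) * (bx - px)) * ax + - ((qx - px) * (ay - py) - (qy - py) * (ax - px)) * bx +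
           ((bx - ax) * (qy - ay) - (by - ay) * (qx - ax)) * px + - ((bx - ax) * (py - ay) - (by - ay) * (px - ax)) * qx ≡ 0ℚ
      l₁ = solve-∀ ringℚ
      l₂ : ∀ ax ay bx by px py qx qy →
           ((qx - px) * (by - py) - (qy - py) * (bx - px)) * ay + - ((qx - px) * (ay - py) - (qy - py) * (ax - px)) * by +
           ((bx - ax) * (qy - ay) - (by - ay) * (qx - ax)) * py + - ((bx - ax) * (py - ay) - (by - ay) * (px - ax)) * qy ≡ 0ℚ
      l₂ = solve-∀ ringℚ

  -- This is the Radon point of the four points: the signs separate a, b from p, q, and the weighted
  -- means of the two pairs coincide.
  radon-point : ∀ {a b p q wa wb wp wq} → AffineDependency a b p q wa wb wp wq →
                0ℚ < wp → 0ℚ < wq → wa < 0ℚ → wb < 0ℚ →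
                ∃[ x ] (x between (a , b) × x between (p , q))
  radon-point {ax , ay} {bx , by} {px , py} {qx , qy} {wa} {wb} {wp} {wq} (dependency e ex ey) 0<wp 0<wq wa<0 wb<0 =
    (X px qx , X py qy) ,
    between-weighted (- wa) (- wb) (ℚ.<⇒≤ (<⇒0<neg wa<0)) (ℚ.<⇒≤ (<⇒0<neg wb<0))
      (subst (0ℚ <_) d≡ 0<d) (onab px qx ax bx ex) (onab py qy ay by ey) ,
    between-weighted wp wq (ℚ.<⇒≤ 0<wp) (ℚ.<⇒≤ 0<wq) 0<d (onpq px qx) (onpq py qy)
    where
    d = wp + wq
    0<d : 0ℚ < d
    0<d = ℚ.+-mono-< 0<wp 0<wq
    instance
      d-positive = positive 0<d
      d-nonZero = ℚ.pos⇒nonZero d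
    i = 1/ d
    X : ℚ → ℚ → ℚ
    X s t = i * (wp * s + wq * t)
    onpq : ∀ s t → d * X s t ≡ wp * s + wq * t
    onpq s t = trans (sym (ℚ.*-assoc d i _)) (trans (cong (_* (wp * s + wq * t)) (ℚ.*-inverseʳ d)) (ℚ.*-identityˡ _))
    move₀ : ∀ a b c d → c + d ≡ - a + - b + (a + b + c + d)
    move₀ = solve-∀ ringℚ
    move₁ : ∀ a b c d x y z w → c * z + d * w ≡ - a * x + - b * y + (a * x + b * y + c * z + d * w)
    move₁ = solve-∀ ringℚ
    d≡ : d ≡ - wa + - wb
    d≡ = trans (move₀ wa wb wp wq) (trans (cong (- wa + - wb +_) e) (ℚ.+-identityʳ _))
    onab : ∀ s t x y → wa * x + wb * y + wp * s + wq * t ≡ 0ℚ → (- wa + - wb) * X s t ≡ - wa * x + - wb * y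
    onab s t x y ez = trans (cong (_* X s t) (sym d≡)) (trans (onpq s t) (trans (move₁ wa wb wp wq x y s t)
      (trans (cong (- wa * x + - wb * y +_) ez) (ℚ.+-identityʳ _))))

  Meet : Point → Point → Point → Point → Set
  Meet a b p q = ∃[ x ] (x between (a , b) × x between (p , q))

  vanish : ∀ {d s} (x : ℚ) → d ≡ 0ℚ → s ≡ 0ℚ → d - s * x ≡ 0ℚ
  vanish x refl refl = cong (λ y → 0ℚ - y) (ℚ.*-zeroˡ x)

  -- The order of the points supplies the two missing signs. If wa + wp were at most 0, summation by
  -- parts would write zero as a forbidden positive combination; so wp is positive, and wb, the
  -- negative of wa + wp + wq, is negative.
  interleaved-meet : ∀ {a b p q wa wb wp wq} → a ≺ p → p ≺ b → b ≺ q →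
                     AffineDependency a b p q wa wb wp wq → wa < 0ℚ → 0ℚ < wq → Meet a b p q
  interleaved-meet {ax , ay} {bx , by} {px , py} {qx , qy} {wa} {wb} {wp} {wq} a≺p p≺b b≺q D@(dependency e ex ey) wa<0 0<wq
    = radon-point D 0<wp 0<wq wa<0 wb<0
    where
    -- Abel summation along a ≺ p ≺ b ≺ q.
    abel : ∀ wa wb wp wq a b p q → - wa * (p - a) + - (wa + wp) * (b - p) + wq * (q - b) ≡
           (wa * a + wb * b + wp * p + wq * q) - (wa + wb + wp + wq) * b
    abel = solve-∀ ringℚ
    0<wa+wp : 0ℚ < wa + wp
    0<wa+wp = ℚ.≰⇒> λ wa+wp≤0 → positive-combination≢0 (<⇒0<neg wa<0) (ℚ.neg-antimono-≤ wa+wp≤0) (ℚ.<⇒≤ 0<wq)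
      (≺⇒LexPositive a≺p) (≺⇒LexPositive p≺b) (≺⇒LexPositive b≺q)
      (trans (abel wa wb wp wq ax bx px qx) (vanish bx ex e)) (trans (abel wa wb wp wq ay by py qy) (vanish by ey e))
    wp≡ : ∀ wa wp → - wa + (wa + wp) ≡ wp
    wp≡ = solve-∀ ringℚ
    0<wp : 0ℚ < wp
    0<wp = subst (0ℚ <_) (wp≡ wa wp) (ℚ.+-mono-< (<⇒0<neg wa<0) 0<wa+wp)
    wb≡ : ∀ wa wb wp wq → - ((wa + wp) + wq) + (wa + wb + wp + wq) ≡ wb
    wb≡ = solve-∀ ringℚ
    wb<0 : wb < 0ℚ
    wb<0 = subst (_< 0ℚ) (trans (sym (trans (cong (- ((wa + wp) + wq) +_) e) (ℚ.+-identityʳ _))) (wb≡ wa wb wp wq))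
             (ℚ.neg-antimono-< (ℚ.+-mono-< 0<wa+wp 0<wq))

  -- If an outer weight were nonnegative, summation by parts starting at that end would have only
  -- nonnegative coefficients, with a positive one at q - p.
  nested-meet : ∀ {a b p q wa wb wp wq} → a ≺ p → p ≺ q → q ≺ b →
                AffineDependency a b p q wa wb wp wq → 0ℚ < wp → 0ℚ < wq → Meet a b p q
  nested-meet {ax , ay} {bx , by} {px , py} {qx , qy} {wa} {wb} {wp} {wq} a≺p p≺q q≺b D@(dependency e ex ey) 0<wp 0<wq
    = radon-point D 0<wp 0<wq wa<0 wb<0
    where
    -- Abel summation along a ≺ p ≺ q ≺ b, from either end.
    abelʳ : ∀ wa wb wp wq a b p q → (wa + wp) * (q - p) + wa * (p - a) + (wa + wp + wq) * (b - q) ≡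
           - ((wa * a + wb * b + wp * p + wq * q) - (wa + wb + wp + wq) * b)
    abelʳ = solve-∀ ringℚ
    abelˡ : ∀ wa wb wp wq a b p q → (wb + wq) * (q - p) + wb * (b - q) + (wb + wq + wp) * (p - a) ≡
           (wa * a + wb * b + wp * p + wq * q) - (wa + wb + wp + wq) * a
    abelˡ = solve-∀ ringℚ
    wa<0 : wa < 0ℚ
    wa<0 = ℚ.≰⇒> λ 0≤wa → positive-combination≢0 (ℚ.+-mono-≤-< 0≤wa 0<wp) 0≤wa
      (ℚ.+-mono-≤ (ℚ.+-mono-≤ 0≤wa (ℚ.<⇒≤ 0<wp)) (ℚ.<⇒≤ 0<wq))
      (≺⇒LexPositive p≺q) (≺⇒LexPositive a≺p) (≺⇒LexPositive q≺b)
      (trans (abelʳ wa wb wp wq ax bx px qx) (cong -_ (vanish bx ex e)))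
      (trans (abelʳ wa wb wp wq ay by py qy) (cong -_ (vanish by ey e)))
    wb<0 : wb < 0ℚ
    wb<0 = ℚ.≰⇒> λ 0≤wb → positive-combination≢0 (ℚ.+-mono-≤-< 0≤wb 0<wq) 0≤wb
      (ℚ.+-mono-≤ (ℚ.+-mono-≤ 0≤wb (ℚ.<⇒≤ 0<wq)) (ℚ.<⇒≤ 0<wp))
      (≺⇒LexPositive p≺q) (≺⇒LexPositive q≺b) (≺⇒LexPositive a≺p)
      (trans (abelˡ wa wb wp wq ax bx px qx) (vanish ax ex e))
      (trans (abelˡ wa wb wp wq ay by py qy) (vanish ay ey e))

  -- The side of a segment on which a point lies, and the parity identity for two segments.

  infix 6 _≺ᵇ_

  opaque
    _≺ᵇ_ : Point → Point → Bool
    a ≺ᵇ b = does (a ≺? b)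

    ≺ᵇ-true : ∀ {a b} → a ≺ b → a ≺ᵇ b ≡ true
    ≺ᵇ-true {a} {b} = dec-true (a ≺? b)

    ≺ᵇ-false : ∀ {a b} → b ≺ a → a ≺ᵇ b ≡ false
    ≺ᵇ-false {a} {b} b≺a = dec-false (a ≺? b) (≺-asym b≺a)

  ≺ᵇ-flip : ∀ {a b} → a ≢ b → a ≺ᵇ b ≡ not (b ≺ᵇ a)
  ≺ᵇ-flip {a} {b} a≢b with ≺-cmp a b
  ... | tri< a≺b _ _ = trans (≺ᵇ-true a≺b) (cong not (sym (≺ᵇ-false a≺b)))
  ... | tri≈ _ e _   = contradiction e a≢b
  ... | tri> _ _ b≺a = trans (≺ᵇ-false b≺a) (cong not (sym (≺ᵇ-true b≺a)))

  opaque
    infix 7 0<ᵇ_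

    0<ᵇ_ : ℚ → Bool
    0<ᵇ x = does (0ℚ ℚ.<? x)

    0<ᵇ-true : ∀ {x} → 0ℚ < x → 0<ᵇ x ≡ true
    0<ᵇ-true {x} = dec-true (0ℚ ℚ.<? x)

    0<ᵇ-false : ∀ {x} → x < 0ℚ → 0<ᵇ x ≡ false
    0<ᵇ-false {x} x<0 = dec-false (0ℚ ℚ.<? x) (ℚ.<-asym x<0)

  -- For a point p off the segment ab, whether p lies lexicographically
  -- strictly between a and b and on the lower side of ab.
  opaque
    under : Point → Point → Point → Bool
    under a b p = (a ≺ᵇ p xor b ≺ᵇ p) ∧ (a ≺ᵇ b xor 0<ᵇ det a b p)

    under-degenerate : ∀ a p → under a a p ≡ false
    under-degenerate a p = cong (_∧ (a ≺ᵇ a xor 0<ᵇ det a a p)) (𝔹.xor-same (a ≺ᵇ p))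

    under-outside : ∀ {a b p} → a ≺ᵇ p ≡ b ≺ᵇ p → under a b p ≡ false
    under-outside {a} {b} {p} e = cong (_∧ (a ≺ᵇ b xor 0<ᵇ det a b p))
      (trans (cong (_xor b ≺ᵇ p) e) (𝔹.xor-same (b ≺ᵇ p)))

    under-inside : ∀ {a b p} → a ≺ p → p ≺ b → under a b p ≡ not (0<ᵇ det a b p)
    under-inside {a} {b} {p} a≺p p≺b = cong₂ _∧_
      (cong₂ _xor_ (≺ᵇ-true a≺p) (≺ᵇ-false p≺b)) (cong (_xor 0<ᵇ det a b p) (≺ᵇ-true (≺-trans a≺p p≺b)))

    under-inside′ : ∀ {a b p} → a ≺ p → p ≺ b → under b a p ≡ 0<ᵇ det b a p
    under-inside′ {a} {b} {p} a≺p p≺b = cong₂ _∧_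
      (cong₂ _xor_ (≺ᵇ-false p≺b) (≺ᵇ-true a≺p)) (cong (_xor 0<ᵇ det b a p) (≺ᵇ-false (≺-trans a≺p p≺b)))

  under-before : ∀ {a b p} → p ≺ a → p ≺ b → under a b p ≡ false
  under-before p≺a p≺b = under-outside (trans (≺ᵇ-false p≺a) (sym (≺ᵇ-false p≺b)))

  under-after : ∀ {a b p} → a ≺ p → b ≺ p → under a b p ≡ false
  under-after a≺p b≺p = under-outside (trans (≺ᵇ-true a≺p) (sym (≺ᵇ-true b≺p)))

  opaque
    unfolding det

    det-swap : ∀ a b p → det b a p ≡ - det a b p
    det-swap (ax , ay) (bx , by) (px , py) = lem ax ay bx by px py
      where
      lem : ∀ ax ay bx by px py → (ax - bx) * (py - by) - (ay - by) * (px - bx) ≡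
            - ((bx - ax) * (py - ay) - (by - ay) * (px - ax))
      lem = solve-∀ ringℚ

  0<ᵇ-neg : ∀ {x} → x ≢ 0ℚ → 0<ᵇ (- x) ≡ not (0<ᵇ x)
  0<ᵇ-neg {x} x≢0 with ℚ.<-cmp 0ℚ x
  ... | tri< p _ _ = trans (0<ᵇ-false (ℚ.neg-antimono-< p)) (cong not (sym (0<ᵇ-true p)))
  ... | tri≈ _ e _ = contradiction (sym e) x≢0
  ... | tri> _ _ p = trans (0<ᵇ-true (<⇒0<neg p)) (cong not (sym (0<ᵇ-false p)))

  0≤1 : 0ℚ ≤ℚ 1ℚ
  0≤1 = ℚ.<⇒≤ (ℚ.positive⁻¹ 1ℚ)

  left-end : ∀ a b → a between (a , b)
  left-end (ax , ay) (bx , by) = 0ℚ , ℚ.≤-refl , 0≤1 , lem ax bx , lem ay by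
    where
    lem : ∀ x y → x ≡ (1ℚ - 0ℚ) * x + 0ℚ * y
    lem = solve-∀ ringℚ

  right-end : ∀ a b → b between (a , b)
  right-end (ax , ay) (bx , by) = 1ℚ , 0≤1 , ℚ.≤-refl , lem ax bx , lem ay by
    where
    lem : ∀ x y → y ≡ (1ℚ - 1ℚ) * x + 1ℚ * y
    lem = solve-∀ ringℚ

  between-swap : ∀ {p a b} → p between (b , a) → p between (a , b)
  between-swap {px , py} {ax , ay} {bx , by} (t , 0≤t , t≤1 , ex , ey) =
    between-weighted t (1ℚ - t) 0≤t (0≤- t≤1) (subst (0ℚ <_) (one t) (ℚ.positive⁻¹ 1ℚ)) (coord ax bx px ex) (coord ay by py ey)
    where
    one : ∀ t → 1ℚ ≡ t + (1ℚ - t)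
    one = solve-∀ ringℚ
    comm : ∀ t a b → (t + (1ℚ - t)) * ((1ℚ - t) * b + t * a) ≡ t * a + (1ℚ - t) * b
    comm = solve-∀ ringℚ
    coord : ∀ a b p → p ≡ (1ℚ - t) * b + t * a → (t + (1ℚ - t)) * p ≡ t * a + (1ℚ - t) * b
    coord a b p refl = comm t a b

  -- Strictly between the ends, exchanging them negates `det`, which is nonzero because p is off the
  -- segment.
  under-sym-≺ : ∀ {a b p} → ¬ (p between (a , b)) → a ≺ b → under a b p ≡ under b a p
  under-sym-≺ {a} {b} {p} off a≺b = go (≺-cmp a p) (≺-cmp p b)
    where
    go : Tri (a ≺ p) (a ≡ p) (p ≺ a) → Tri (p ≺ b) (p ≡ b) (b ≺ p) → under a b p ≡ under b a p
    go (tri> _ _ p≺a) _ = trans (under-before p≺a p≺b) (sym (under-before p≺b p≺a))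
      where p≺b = ≺-trans p≺a a≺b
    go _ (tri> _ _ b≺p) = trans (under-after a≺p b≺p) (sym (under-after b≺p a≺p))
      where a≺p = ≺-trans a≺b b≺p
    go (tri≈ _ refl _) _ = contradiction (left-end a b) off
    go _ (tri≈ _ refl _) = contradiction (right-end a b) off
    go (tri< a≺p _ _) (tri< p≺b _ _) = begin
      under a b p          ≡⟨ under-inside a≺p p≺b ⟩
      not (0<ᵇ det a b p)  ≡⟨ sym (0<ᵇ-neg λ e → off (collinear-between a≺p p≺b e)) ⟩
      0<ᵇ (- det a b p)    ≡⟨ cong 0<ᵇ_ (sym (det-swap a b p)) ⟩
      0<ᵇ det b a p        ≡⟨ sym (under-inside′ a≺p p≺b) ⟩
      under b a p          ∎
      where open ≡-Reasoning

  under-sym : ∀ a b p → ¬ (p between (a , b)) → under a b p ≡ under b a p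
  under-sym a b p off with ≺-cmp a b
  ... | tri< a≺b _ _ = under-sym-≺ off a≺b
  ... | tri≈ _ refl _ = refl
  ... | tri> _ _ b≺a = sym (under-sym-≺ (λ on → off (between-swap on)) b≺a)

  DisjointSegments : Point → Point → Point → Point → Set
  DisjointSegments a b p q = ¬ Meet a b p q

  data Sign (x : ℚ) : Set where
    plus  : 0ℚ < x → Sign x
    minus : x < 0ℚ → Sign x

  sign : ∀ x → x ≢ 0ℚ → Sign x
  sign x x≢0 with ℚ.<-cmp 0ℚ x
  ... | tri< p _ _ = plus p
  ... | tri≈ _ e _ = contradiction (sym e) x≢0
  ... | tri> _ _ p = minus p

  under-pos : ∀ {a b p} → a ≺ p → p ≺ b → 0ℚ < det a b p → under a b p ≡ false
  under-pos a≺p p≺b h = trans (under-inside a≺p p≺b) (cong not (0<ᵇ-true h))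

  under-neg : ∀ {a b p} → a ≺ p → p ≺ b → det a b p < 0ℚ → under a b p ≡ true
  under-neg a≺p p≺b h = trans (under-inside a≺p p≺b) (cong not (0<ᵇ-false h))

  inside-sign : ∀ {a b p} → a ≺ p → p ≺ b → ¬ (p between (a , b)) → Sign (det a b p)
  inside-sign {a} {b} {p} a≺p p≺b off = sign (det a b p) λ e → off (collinear-between a≺p p≺b e)

  -- Above the stretch from p to b, the same one of the two disjoint segments is the upper one at
  -- both ends. If it is ab, then p is below ab and b is above pq; otherwise it is the other way
  -- round.
  interleaved-parity : ∀ {a b p q} → a ≺ p → p ≺ b → b ≺ q → DisjointSegments a b p q →
                       under a b p xor under p q b ≡ true
  interleaved-parity {a} {b} {p} {q} a≺p p≺b b≺q dis =
    go (inside-sign a≺p p≺b (λ on → dis (p , on , left-end p q)))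
       (inside-sign p≺b b≺q (λ on → dis (b , right-end a b , on)))
    where
    go : Sign (det a b p) → Sign (det p q b) → under a b p xor under p q b ≡ true
    go (plus h) (minus k) = cong₂ _xor_ (under-pos a≺p p≺b h) (under-neg p≺b b≺q k)
    go (minus h) (plus k) = cong₂ _xor_ (under-neg a≺p p≺b h) (under-pos p≺b b≺q k)
    go (plus h) (plus k) = contradiction
      (interleaved-meet a≺p p≺b b≺q (neg-dependency (det-dependency a b p q)) (ℚ.neg-antimono-< k)
        (<⇒0<neg (ℚ.neg-antimono-< h))) dis
    go (minus h) (minus k) = contradiction
      (interleaved-meet a≺p p≺b b≺q (det-dependency a b p q) k (<⇒0<neg h)) dis

  -- The segment pq stays over the stretch from a to b, so it cannot change sides without meeting
  -- ab.
  nested-parity : ∀ {a b p q} → a ≺ p → p ≺ q → q ≺ b → DisjointSegments a b p q →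
                  under a b p ≡ under a b q
  nested-parity {a} {b} {p} {q} a≺p p≺q q≺b dis =
    go (inside-sign a≺p p≺b (λ on → dis (p , on , left-end p q)))
       (inside-sign a≺q q≺b (λ on → dis (q , on , right-end p q)))
    where
    p≺b = ≺-trans p≺q q≺b
    a≺q = ≺-trans a≺p p≺q
    go : Sign (det a b p) → Sign (det a b q) → under a b p ≡ under a b q
    go (plus h) (plus k) = trans (under-pos a≺p p≺b h) (sym (under-pos a≺q q≺b k))
    go (minus h) (minus k) = trans (under-neg a≺p p≺b h) (sym (under-neg a≺q q≺b k))
    go (plus h) (minus k) = contradiction
      (nested-meet a≺p p≺q q≺b (neg-dependency (det-dependency a b p q)) (<⇒0<neg k)
        (<⇒0<neg (ℚ.neg-antimono-< h))) dis
    go (minus h) (plus k) = contradiction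
      (nested-meet a≺p p≺q q≺b (det-dependency a b p q) k (<⇒0<neg h)) dis

  -- For four distinct points the right-hand side is 1 exactly when one of a and b, but not the
  -- other, lies between p and q in the order.
  SegmentParity : Point → Point → Point → Point → Set
  SegmentParity a b p q =
    (under a b p xor under a b q) xor (under p q a xor under p q b)
      ≡ (p ≺ᵇ a xor q ≺ᵇ a) xor (p ≺ᵇ b xor q ≺ᵇ b)

  -- With a first among the four points, b comes before p, between p and q, or after q: the two
  -- stretches are disjoint, interleaved or nested.
  segment-parity-sorted : ∀ {a b p q} → DisjointSegments a b p q → a ≺ b → p ≺ q → a ≺ p → SegmentParity a b p q
  segment-parity-sorted {a} {b} {p} {q} dis a≺b p≺q a≺p = go (≺-cmp p b) (≺-cmp q b)
    where
    a≺q = ≺-trans a≺p p≺q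
    with-values : ∀ {u v w x y} → under a b p ≡ u → under a b q ≡ v → under p q b ≡ w →
                  p ≺ᵇ b ≡ x → q ≺ᵇ b ≡ y → (u xor v) xor w ≡ x xor y → SegmentParity a b p q
    with-values refl refl refl refl refl h = trans
      (cong (λ z → (under a b p xor under a b q) xor (z xor under p q b)) (under-before a≺p a≺q))
      (trans h (sym (cong (_xor (p ≺ᵇ b xor q ≺ᵇ b)) (cong₂ _xor_ (≺ᵇ-false a≺p) (≺ᵇ-false a≺q)))))
    go : Tri (p ≺ b) (p ≡ b) (b ≺ p) → Tri (q ≺ b) (q ≡ b) (b ≺ q) → SegmentParity a b p q
    go (tri≈ _ refl _) _ = contradiction (b , right-end a b , left-end b q) dis
    go _ (tri≈ _ refl _) = contradiction (b , right-end a b , right-end p b) dis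
    go (tri> _ _ b≺p) _ = with-values (under-after a≺p b≺p) (under-after a≺q b≺q) (under-before b≺p b≺q)
      (≺ᵇ-false b≺p) (≺ᵇ-false b≺q) refl
      where b≺q = ≺-trans b≺p p≺q
    go (tri< p≺b _ _) (tri< q≺b _ _) = with-values (nested-parity a≺p p≺q q≺b dis) refl (under-after p≺b q≺b)
      (≺ᵇ-true p≺b) (≺ᵇ-true q≺b) (cong (_xor false) (𝔹.xor-same (under a b q)))
    go (tri< p≺b _ _) (tri> _ _ b≺q) = with-values refl (under-after a≺q b≺q) refl
      (≺ᵇ-true p≺b) (≺ᵇ-false b≺q)
      (trans (cong (_xor under p q b) (𝔹.xor-identityʳ (under a b p))) (interleaved-parity a≺p p≺b b≺q dis))

  -- Exchanging the segments negates each of the four comparisons, and an even number of negations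
  -- cancels.
  segment-parity-swap : ∀ {a b p q} → DisjointSegments a b p q → SegmentParity p q a b → SegmentParity a b p q
  segment-parity-swap {a} {b} {p} {q} dis h = begin
    (under a b p xor under a b q) xor (under p q a xor under p q b)
      ≡⟨ 𝔹.xor-comm (under a b p xor under a b q) _ ⟩
    (under p q a xor under p q b) xor (under a b p xor under a b q)
      ≡⟨ h ⟩
    (a ≺ᵇ p xor b ≺ᵇ p) xor (a ≺ᵇ q xor b ≺ᵇ q)
      ≡⟨ cong₂ _xor_ (cong₂ _xor_ (≺ᵇ-flip (λ { refl → dis (a , left-end a b , left-end a q) }))
                                  (≺ᵇ-flip (λ { refl → dis (b , right-end a b , left-end b q) })))
                     (cong₂ _xor_ (≺ᵇ-flip (λ { refl → dis (a , left-end a b , right-end p a) }))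
                                  (≺ᵇ-flip (λ { refl → dis (b , right-end a b , right-end p b) }))) ⟩
    (not (p ≺ᵇ a) xor not (p ≺ᵇ b)) xor (not (q ≺ᵇ a) xor not (q ≺ᵇ b))
      ≡⟨ cong₂ _xor_ (𝔹.xor-annihilates-not (p ≺ᵇ a) (p ≺ᵇ b)) (𝔹.xor-annihilates-not (q ≺ᵇ a) (q ≺ᵇ b)) ⟩
    (p ≺ᵇ a xor p ≺ᵇ b) xor (q ≺ᵇ a xor q ≺ᵇ b)
      ≡⟨ interchange (p ≺ᵇ a) (p ≺ᵇ b) (q ≺ᵇ a) (q ≺ᵇ b) ⟩
    (p ≺ᵇ a xor q ≺ᵇ a) xor (p ≺ᵇ b xor q ≺ᵇ b) ∎
    where
    open ≡-Reasoning
    interchange : ∀ w x y z → (w xor x) xor (y xor z) ≡ (w xor y) xor (x xor z)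
    interchange = solve 4 (λ w x y z → (w :+ x) :+ (y :+ z) := (w :+ y) :+ (x :+ z)) refl
      where open xor-∧-Solver

  segment-parity-directed : ∀ {a b p q} → DisjointSegments a b p q → a ≺ b → p ≺ q → SegmentParity a b p q
  segment-parity-directed {a} {b} {p} {q} dis a≺b p≺q with ≺-cmp a p
  ... | tri< a≺p _ _ = segment-parity-sorted dis a≺b p≺q a≺p
  ... | tri≈ _ refl _ = contradiction (a , left-end a b , left-end a q) dis
  ... | tri> _ _ p≺a = segment-parity-swap dis
    (segment-parity-sorted (λ (x , x∈pq , x∈ab) → dis (x , x∈ab , x∈pq)) p≺q a≺b p≺a)

  reverseˡ : ∀ {a b p q} → DisjointSegments a b p q → SegmentParity b a p q → SegmentParity a b p q
  reverseˡ {a} {b} {p} {q} dis h = begin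
    (under a b p xor under a b q) xor (under p q a xor under p q b)
      ≡⟨ cong₂ _xor_ (cong₂ _xor_ (under-sym a b p λ on → dis (p , on , left-end p q))
                                  (under-sym a b q λ on → dis (q , on , right-end p q)))
                     (𝔹.xor-comm (under p q a) (under p q b)) ⟩
    (under b a p xor under b a q) xor (under p q b xor under p q a)
      ≡⟨ h ⟩
    (p ≺ᵇ b xor q ≺ᵇ b) xor (p ≺ᵇ a xor q ≺ᵇ a)
      ≡⟨ 𝔹.xor-comm (p ≺ᵇ b xor q ≺ᵇ b) _ ⟩
    (p ≺ᵇ a xor q ≺ᵇ a) xor (p ≺ᵇ b xor q ≺ᵇ b) ∎
    where open ≡-Reasoning

  reverseʳ : ∀ {a b p q} → DisjointSegments a b p q → SegmentParity a b q p → SegmentParity a b p q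
  reverseʳ {a} {b} {p} {q} dis h = begin
    (under a b p xor under a b q) xor (under p q a xor under p q b)
      ≡⟨ cong₂ _xor_ (𝔹.xor-comm (under a b p) (under a b q))
                     (cong₂ _xor_ (under-sym p q a λ on → dis (a , left-end a b , on))
                                  (under-sym p q b λ on → dis (b , right-end a b , on))) ⟩
    (under a b q xor under a b p) xor (under q p a xor under q p b)
      ≡⟨ h ⟩
    (q ≺ᵇ a xor p ≺ᵇ a) xor (q ≺ᵇ b xor p ≺ᵇ b)
      ≡⟨ cong₂ _xor_ (𝔹.xor-comm (q ≺ᵇ a) (p ≺ᵇ a)) (𝔹.xor-comm (q ≺ᵇ b) (p ≺ᵇ b)) ⟩
    (p ≺ᵇ a xor q ≺ᵇ a) xor (p ≺ᵇ b xor q ≺ᵇ b) ∎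
    where open ≡-Reasoning

  segment-parity : ∀ {a b p q} → DisjointSegments a b p q → SegmentParity a b p q
  segment-parity {a} {b} {p} {q} dis = go (≺-cmp a b) (≺-cmp p q)
    where
    go : Tri (a ≺ b) (a ≡ b) (b ≺ a) → Tri (p ≺ q) (p ≡ q) (q ≺ p) → SegmentParity a b p q
    go (tri< a≺b _ _) (tri< p≺q _ _) = segment-parity-directed dis a≺b p≺q
    go (tri≈ _ refl _) _ = trans
      (cong₂ _xor_ (cong₂ _xor_ (under-degenerate a p) (under-degenerate a q)) (𝔹.xor-same (under p q a)))
      (sym (𝔹.xor-same (p ≺ᵇ a xor q ≺ᵇ a)))
    go _ (tri≈ _ refl _) = trans
      (cong₂ _xor_ (𝔹.xor-same (under a b p)) (cong₂ _xor_ (under-degenerate p a) (under-degenerate p b)))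
      (sym (cong₂ _xor_ (𝔹.xor-same (p ≺ᵇ a)) (𝔹.xor-same (p ≺ᵇ b))))
    go (tri> _ _ b≺a) (tri< p≺q _ _) = reverseˡ dis
      (segment-parity-directed (λ (x , x∈ba , x∈pq) → dis (x , between-swap x∈ba , x∈pq)) b≺a p≺q)
    go (tri< a≺b _ _) (tri> _ _ q≺p) = reverseʳ dis
      (segment-parity-directed (λ (x , x∈ab , x∈qp) → dis (x , x∈ab , between-swap x∈qp)) a≺b q≺p)
    go (tri> _ _ b≺a) (tri> _ _ q≺p) = reverseʳ dis (reverseˡ (λ (x , x∈ab , x∈qp) → dis (x , x∈ab , between-swap x∈qp))
      (segment-parity-directed (λ (x , x∈ba , x∈qp) → dis (x , between-swap x∈ba , between-swap x∈qp)) b≺a q≺p))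

  -- The parity identity for polygonal curves.

  end : Point → List Point → Point
  end a []       = a
  end a (b ∷ ps) = end b ps

  end-++ : ∀ a ps z → end a (ps ++ z ∷ []) ≡ z
  end-++ a []       z = refl
  end-++ a (b ∷ ps) z = end-++ b ps z

  on-start : ∀ a ps → OnCurve (a ∷ ps) a
  on-start a []       = refl
  on-start a (b ∷ ps) = inj₁ (left-end a b)

  on-end : ∀ a ps → OnCurve (a ∷ ps) (end a ps)
  on-end a []       = refl
  on-end a (b ∷ ps) = inj₂ (on-end b ps)

  curve-under : Point → List Point → Point → Bool
  curve-under a []       p = false
  curve-under a (b ∷ ps) p = under a b p xor curve-under b ps p

  parity-glue : ∀ u v w s t c d k l m i j n →
    (u xor v) xor (s xor t) ≡ (k xor l) xor (i xor j) →
    (v xor w) xor (c xor d) ≡ (l xor m) xor (j xor n) →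
    (u xor w) xor ((s xor c) xor (t xor d)) ≡ (k xor m) xor (i xor n)
  parity-glue u v w s t c d k l m i j n e f =
    trans (lemˡ u v w s t c d) (trans (cong₂ _xor_ e f) (lemʳ k l m i j n))
    where
    open xor-∧-Solver
    lemˡ : ∀ u v w s t c d → (u xor w) xor ((s xor c) xor (t xor d)) ≡ ((u xor v) xor (s xor t)) xor ((v xor w) xor (c xor d))
    lemˡ = solve 7 (λ u v w s t c d → (u :+ w) :+ ((s :+ c) :+ (t :+ d)) := ((u :+ v) :+ (s :+ t)) :+ ((v :+ w) :+ (c :+ d))) refl
    lemʳ : ∀ k l m i j n → ((k xor l) xor (i xor j)) xor ((l xor m) xor (j xor n)) ≡ (k xor m) xor (i xor n)
    lemʳ = solve 6 (λ k l m i j n → ((k :+ l) :+ (i :+ j)) :+ ((l :+ m) :+ (j :+ n)) := (k :+ m) :+ (i :+ n)) refl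

  -- When the identities for the successive segments are added, the terms at each inner corner occur
  -- twice and cancel.
  segment-curve-parity : ∀ {a b} p ps → (∀ x → x between (a , b) → ¬ OnCurve (p ∷ ps) x) →
    (under a b p xor under a b (end p ps)) xor (curve-under p ps a xor curve-under p ps b)
      ≡ (p ≺ᵇ a xor end p ps ≺ᵇ a) xor (p ≺ᵇ b xor end p ps ≺ᵇ b)
  segment-curve-parity {a} {b} p [] dis = trans
    (cong (_xor false) (𝔹.xor-same (under a b p)))
    (sym (cong₂ _xor_ (𝔹.xor-same (p ≺ᵇ a)) (𝔹.xor-same (p ≺ᵇ b))))
  segment-curve-parity {a} {b} p (q ∷ ps) dis = parity-glue
    (under a b p) (under a b q) (under a b e)
    (under p q a) (under p q b) (curve-under q ps a) (curve-under q ps b)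
    (p ≺ᵇ a) (q ≺ᵇ a) (e ≺ᵇ a) (p ≺ᵇ b) (q ≺ᵇ b) (e ≺ᵇ b)
    (segment-parity (λ (x , x∈ab , x∈pq) → dis x x∈ab (inj₁ x∈pq)))
    (segment-curve-parity q ps (λ x x∈ab x∈ps → dis x x∈ab (inj₂ x∈ps)))
    where e = end q ps

  curve-parity : ∀ a as p ps → (∀ x → OnCurve (a ∷ as) x → ¬ OnCurve (p ∷ ps) x) →
    (curve-under a as p xor curve-under a as (end p ps)) xor (curve-under p ps a xor curve-under p ps (end a as))
      ≡ (p ≺ᵇ a xor end p ps ≺ᵇ a) xor (p ≺ᵇ end a as xor end p ps ≺ᵇ end a as)
  curve-parity a [] p ps dis = trans
    (𝔹.xor-same (curve-under p ps a))
    (sym (𝔹.xor-same (p ≺ᵇ a xor end p ps ≺ᵇ a)))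
  curve-parity a (b ∷ as) p ps dis = glue
    (under a b p) (under a b e) (curve-under b as p) (curve-under b as e)
    (curve-under p ps a) (curve-under p ps b) (curve-under p ps z)
    (p ≺ᵇ a xor e ≺ᵇ a) (p ≺ᵇ b xor e ≺ᵇ b) (p ≺ᵇ z xor e ≺ᵇ z)
    (segment-curve-parity p ps (λ x x∈ab → dis x (inj₁ x∈ab)))
    (curve-parity b as p ps (λ x x∈as → dis x (inj₂ x∈as)))
    where
    e = end p ps
    z = end b as
    glue : ∀ s t c d u v w k l m →
      (s xor t) xor (u xor v) ≡ k xor l →
      (c xor d) xor (v xor w) ≡ l xor m →
      ((s xor c) xor (t xor d)) xor (u xor w) ≡ k xor m
    glue s t c d u v w k l m e f =
      trans (lemˡ s t c d u v w) (trans (cong₂ _xor_ e f) (lemʳ k l m))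
      where
      open xor-∧-Solver
      lemˡ : ∀ s t c d u v w → ((s xor c) xor (t xor d)) xor (u xor w) ≡ ((s xor t) xor (u xor v)) xor ((c xor d) xor (v xor w))
      lemˡ = solve 7 (λ s t c d u v w → ((s :+ c) :+ (t :+ d)) :+ (u :+ w) := ((s :+ t) :+ (u :+ v)) :+ ((c :+ d) :+ (v :+ w))) refl
      lemʳ : ∀ k l m → (k xor l) xor (l xor m) ≡ k xor m
      lemʳ = solve 3 (λ k l m → (k :+ l) :+ (l :+ m) := k :+ m) refl

  curve-under-far : ∀ a as z → (∀ x → OnCurve (a ∷ as) x → proj₁ x < proj₁ z) → curve-under a as z ≡ false
  curve-under-far a []       z far = refl
  curve-under-far a (b ∷ as) z far = cong₂ _xor_
    (under-after (first< (far a (on-start a (b ∷ as)))) (first< (far b (inj₂ (on-start b as)))))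
    (curve-under-far b as z (λ x x∈as → far x (inj₂ x∈as)))

  -- The tournament of an outerplanar drawing.

  IsTournament : ∀ {n} → (Fin n → Fin n → Bool) → Set
  IsTournament σ = ∀ x y → x ≢ y → σ x y ≡ not (σ y x)

  -- If σ is a linear order, the sum is 1 exactly when the chords ab and cd cross.
  EvenlyCrossing : ∀ {n} → Graph n → (Fin n → Fin n → Bool) → Set
  EvenlyCrossing G σ = ∀ {a b c d} → a ~ b → c ~ d → a ≢ c → a ≢ d → b ≢ c → b ≢ d →
    (σ a c xor σ a d) xor (σ b c xor σ b d) ≡ false
    where open Graph G

  module _ {n} {G : Graph n} (D : PlaneDrawing G) (outer : ∀ v → PlaneDrawing.OnOuterFace D v) where
    open Graph G
    open PlaneDrawing D

    target : Fin n → Point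
    target v = proj₁ (outer v)

    exit : Fin n → List Point
    exit v = proj₁ (proj₂ (outer v)) ++ target v ∷ []

    exit-end : ∀ v → end (pos v) (exit v) ≡ target v
    exit-end v = end-++ (pos v) (proj₁ (proj₂ (outer v))) (target v)

    edge : Fin n → Fin n → List Point
    edge u v = bends u v ++ pos v ∷ []

    edge-end : ∀ u v → end (pos u) (edge u v) ≡ pos v
    edge-end u v = end-++ (pos u) (bends u v) (pos v)

    -- The added comparison absorbs the order terms of `curve-parity`, so that `edge-under` holds
    -- without remainder.
    η : Fin n → Fin n → Bool
    η v a = curve-under (pos v) (exit v) (pos a) xor pos v ≺ᵇ pos a

    -- The exit of c misses the edge ab and ends beyond it.
    edge-under : ∀ {a b c} → a ~ b → a ≢ c → b ≢ c → curve-under (pos a) (edge a b) (pos c) ≡ η c a xor η c b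
    edge-under {a} {b} {c} a~b a≢c b≢c = solve-for
      (curve-under (pos a) (edge a b) (pos c)) (curve-under (pos c) (exit c) (pos a)) (curve-under (pos c) (exit c) (pos b))
      (pos c ≺ᵇ pos a) (pos c ≺ᵇ pos b)
      (curve-under-far (pos a) (edge a b) z (λ x x∈ab → beyond x (inj₂ (a , b , a~b , x∈ab))))
      (≺ᵇ-false (first< (beyond (pos a) (inj₁ (a , refl)))))
      (≺ᵇ-false (first< (beyond (pos b) (inj₁ (b , refl)))))
      (subst₂ (λ e f → (curve-under (pos a) (edge a b) (pos c) xor curve-under (pos a) (edge a b) e) xor
                       (curve-under (pos c) (exit c) (pos a) xor curve-under (pos c) (exit c) f)
                         ≡ (pos c ≺ᵇ pos a xor e ≺ᵇ pos a) xor (pos c ≺ᵇ f xor e ≺ᵇ f))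
        (exit-end c) (edge-end a b)
        (curve-parity (pos a) (edge a b) (pos c) (exit c) disjoint))
      where
      z = target c
      beyond : Beyond z
      beyond = proj₁ (proj₂ (proj₂ (outer c)))
      disjoint : ∀ x → OnCurve (curve a b) x → ¬ OnCurve (pos c ∷ exit c) x
      disjoint x x∈ab x∈c
        with refl ← proj₂ (proj₂ (proj₂ (outer c))) x x∈c (inj₂ (a , b , a~b , x∈ab))
        with vertex-free a b c a~b x∈ab
      ... | inj₁ e = a≢c (sym e)
      ... | inj₂ e = b≢c (sym e)
      solve-for : ∀ u s t k m {w l o} → w ≡ false → l ≡ false → o ≡ false →
        (u xor w) xor (s xor t) ≡ (k xor l) xor (m xor o) → u ≡ (s xor k) xor (t xor m)
      solve-for u s t k m refl refl refl e =
        trans (lemˡ u s t) (trans (cong (_xor (s xor t)) e) (lemʳ s t k m))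
        where
        open xor-∧-Solver
        lemˡ : ∀ u s t → u ≡ ((u xor false) xor (s xor t)) xor (s xor t)
        lemˡ = solve 3 (λ u s t → u := ((u :+ con false) :+ (s :+ t)) :+ (s :+ t)) refl
        lemʳ : ∀ s t k m → ((k xor false) xor (m xor false)) xor (s xor t) ≡ (s xor k) xor (t xor m)
        lemʳ = solve 4 (λ s t k m → ((k :+ con false) :+ (m :+ con false)) :+ (s :+ t) := (s :+ k) :+ (t :+ m)) refl

    -- In the parity identity for edges ab and cd, `edge-under` turns each of the four counts into
    -- two values of `η`. The eight values and the four comparisons regroup into one such expression
    -- for each of the pairs ac, ad, bc, bd. The comparison is the only part that is not symmetric,
    -- which makes it a tournament.
    drawing-tournament : Fin n → Fin n → Bool
    drawing-tournament a c = (η a c xor η c a) xor pos c ≺ᵇ pos a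

    drawing-isTournament : IsTournament drawing-tournament
    drawing-isTournament a c a≢c = trans
      (cong₂ _xor_ (𝔹.xor-comm (η a c) (η c a)) (≺ᵇ-flip λ e → a≢c (sym (pos-injective c a e))))
      (sym (𝔹.not-distribʳ-xor (η c a xor η a c) (pos a ≺ᵇ pos c)))

    drawing-evenlyCrossing : EvenlyCrossing G drawing-tournament
    drawing-evenlyCrossing {a} {b} {c} {d} a~b c~d a≢c a≢d b≢c b≢d =
      combine (η c a) (η c b) (η d a) (η d b) (η a c) (η a d) (η b c) (η b d)
        (pos c ≺ᵇ pos a) (pos d ≺ᵇ pos a) (pos c ≺ᵇ pos b) (pos d ≺ᵇ pos b)
        (edge-under a~b a≢c b≢c) (edge-under a~b a≢d b≢d)
        (edge-under c~d (a≢c ∘sym) (a≢d ∘sym)) (edge-under c~d (b≢c ∘sym) (b≢d ∘sym))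
        (subst₂ (λ e f → (curve-under (pos a) (edge a b) (pos c) xor curve-under (pos a) (edge a b) e) xor
                         (curve-under (pos c) (edge c d) (pos a) xor curve-under (pos c) (edge c d) f)
                           ≡ (pos c ≺ᵇ pos a xor e ≺ᵇ pos a) xor (pos c ≺ᵇ f xor e ≺ᵇ f))
          (edge-end c d) (edge-end a b)
          (curve-parity (pos a) (edge a b) (pos c) (edge c d) disjoint))
      where
      _∘sym : ∀ {x y : Fin n} → x ≢ y → y ≢ x
      (x≢y ∘sym) e = x≢y (sym e)
      disjoint : ∀ x → OnCurve (curve a b) x → ¬ OnCurve (curve c d) x
      disjoint x x∈ab x∈cd
        -- A common point of two edges is a vertex, and a vertex on an edge is one of its ends; but
        -- the edges share no end.
        with w , refl ← edges-cross-free a b c d a~b c~d (λ { (inj₁ (e , _)) → a≢c e ; (inj₂ (e , _)) → a≢d e }) x x∈ab x∈cd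
        with vertex-free a b w a~b x∈ab | vertex-free c d w c~d x∈cd
      ... | inj₁ refl | inj₁ e = a≢c e
      ... | inj₁ refl | inj₂ e = a≢d e
      ... | inj₂ refl | inj₁ e = b≢c e
      ... | inj₂ refl | inj₂ e = b≢d e
      combine : ∀ ca cb da db ac ad bc bd k l m o {u v s t} →
        u ≡ ca xor cb → v ≡ da xor db → s ≡ ac xor ad → t ≡ bc xor bd →
        (u xor v) xor (s xor t) ≡ (k xor l) xor (m xor o) →
        (((ac xor ca) xor k) xor ((ad xor da) xor l)) xor (((bc xor cb) xor m) xor ((bd xor db) xor o)) ≡ false
      combine ca cb da db ac ad bc bd k l m o refl refl refl refl e = trans
        (lem ca cb da db ac ad bc bd k l m o)
        (trans (cong (_xor ((k xor l) xor (m xor o))) e) (𝔹.xor-same ((k xor l) xor (m xor o))))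
        where
        open xor-∧-Solver
        lem : ∀ ca cb da db ac ad bc bd k l m o →
          (((ac xor ca) xor k) xor ((ad xor da) xor l)) xor (((bc xor cb) xor m) xor ((bd xor db) xor o))
          ≡ (((ca xor cb) xor (da xor db)) xor ((ac xor ad) xor (bc xor bd))) xor ((k xor l) xor (m xor o))
        lem = solve 12 (λ ca cb da db ac ad bc bd k l m o →
          (((ac :+ ca) :+ k) :+ ((ad :+ da) :+ l)) :+ (((bc :+ cb) :+ m) :+ ((bd :+ db) :+ o))
          := (((ca :+ cb) :+ (da :+ db)) :+ ((ac :+ ad) :+ (bc :+ bd))) :+ ((k :+ l) :+ (m :+ o))) refl

open CurveParity

-- From a tournament to a noncrossing linear order.

module LinearLayout where

  open import Data.Nat using (_+_; _<_; _<?_)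

  least : ∀ {n} (f : Fin n → ℕ) {P : Pred (Fin n) 0ℓ} → Decidable P → ∃ P →
          ∃[ m ] (P m × (∀ y → P y → f m ≤ f y))
  least f {P} P? (x , px) = go (suc (f x)) x px ℕ.≤-refl
    where
    go : ∀ k x → P x → f x < k → ∃[ m ] (P m × (∀ y → P y → f m ≤ f y))
    go (suc k) x px (s≤s fx≤k) with Fin.any? (λ y → P? y ×-dec (f y <? f x))
    ... | yes (y , py , fy<fx) = go k y py (ℕ.<-≤-trans fy<fx fx≤k)
    ... | no none = x , px , λ y py → ℕ.≮⇒≥ λ fy<fx → none (y , py , fy<fx)

  module _ {A : Set} {P Q : Pred A 0ℓ} (P? : Decidable P) (Q? : Decidable Q) where

    length-filter-mono : ∀ xs → (∀ {x} → x ∈ xs → P x → Q x) → length (filter P? xs) ≤ length (filter Q? xs)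
    length-filter-mono [] P⊆Q = z≤n
    length-filter-mono (x ∷ xs) P⊆Q with P? x | Q? x
    ... | yes px | yes qx = s≤s (length-filter-mono xs (P⊆Q ∘ there))
    ... | yes px | no ¬qx = contradiction (P⊆Q (here refl) px) ¬qx
    ... | no _   | yes _  = ℕ.m≤n⇒m≤1+n (length-filter-mono xs (P⊆Q ∘ there))
    ... | no _   | no _   = length-filter-mono xs (P⊆Q ∘ there)

    length-filter-mono-< : ∀ xs → (∀ {x} → x ∈ xs → P x → Q x) → ∀ {y} → y ∈ xs → ¬ P y → Q y →
                           length (filter P? xs) < length (filter Q? xs)
    length-filter-mono-< (x ∷ xs) P⊆Q (here refl) ¬py qy with P? x | Q? x
    ... | yes px | _      = contradiction px ¬py
    ... | no _   | no ¬qx = contradiction qy ¬qx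
    ... | no _   | yes _  = s≤s (length-filter-mono xs (P⊆Q ∘ there))
    length-filter-mono-< (x ∷ xs) P⊆Q (there y∈xs) ¬py qy with P? x | Q? x
    ... | yes px | yes qx = s≤s (length-filter-mono-< xs (P⊆Q ∘ there) y∈xs ¬py qy)
    ... | yes px | no ¬qx = contradiction (P⊆Q (here refl) px) ¬qx
    ... | no _   | yes _  = ℕ.m≤n⇒m≤1+n (length-filter-mono-< xs (P⊆Q ∘ there) y∈xs ¬py qy)
    ... | no _   | no _   = length-filter-mono-< xs (P⊆Q ∘ there) y∈xs ¬py qy

  filter-shorter : ∀ {A : Set} {P : Pred A 0ℓ} (P? : Decidable P) xs {y} → y ∈ xs → ¬ P y → length (filter P? xs) < length xs
  filter-shorter P? xs y∈xs ¬py = List.filter-notAll P? xs (lose y∈xs ¬py)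

  data Zone : Set where
    left middle right : Zone

  _≟ᶻ_ : (i j : Zone) → Dec (i ≡ j)
  left   ≟ᶻ left   = yes refl
  left   ≟ᶻ middle = no λ ()
  left   ≟ᶻ right  = no λ ()
  middle ≟ᶻ left   = no λ ()
  middle ≟ᶻ middle = yes refl
  middle ≟ᶻ right  = no λ ()
  right  ≟ᶻ left   = no λ ()
  right  ≟ᶻ middle = no λ ()
  right  ≟ᶻ right  = yes refl

  module _ {n} (G : Graph n) where
    open Graph G

    private V = Fin n

    -- A linear order of U without crossing edges.  P and Q are the
    -- neighbourhoods of an imaginary first and last vertex, whose edges are
    -- not crossed either.
    record Layout (U : List V) (P Q : Pred V 0ℓ) : Set where
      field
        rank        : V → ℕ
        size        : ℕ
        rank<size   : ∀ {x} → x ∈ U → rank x < size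
        injective   : ∀ {x y} → x ∈ U → y ∈ U → rank x ≡ rank y → x ≡ y
        noncrossing : ∀ {x y z w} → x ∈ U → y ∈ U → z ∈ U → w ∈ U → x ~ y → z ~ w →
                      rank x < rank z → rank z < rank y → ¬ (rank y < rank w)
        P-visible   : ∀ {x y z} → x ∈ U → y ∈ U → z ∈ U → P x → y ~ z → rank y < rank x → ¬ (rank x < rank z)
        Q-visible   : ∀ {x y z} → x ∈ U → y ∈ U → z ∈ U → Q x → y ~ z → rank y < rank x → ¬ (rank x < rank z)
        P≤Q         : ∀ {x y} → x ∈ U → y ∈ U → P x → Q y → ¬ (rank y < rank x)

    -- The left zone, at most one middle vertex and the right zone are placed in this order. The
    -- middle vertex acts as the last imaginary vertex of the left part and the first one of the
    -- right part, through `Q′` and `P′`. If no vertex is in the middle zone, two parts without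
    -- edges between them are put side by side. Both ways of cutting the graph are instances.
    module _ {U UL UR : List V} {P Q P′ Q′ : Pred V 0ℓ} (zone : V → Zone)
      (in-left  : ∀ {x} → x ∈ U → zone x ≡ left → x ∈ UL)
      (in-right : ∀ {x} → x ∈ U → zone x ≡ right → x ∈ UR)
      (middle-unique : ∀ {x y} → x ∈ U → y ∈ U → zone x ≡ middle → zone y ≡ middle → x ≡ y)
      (left≁right : ∀ {x y} → x ∈ U → y ∈ U → zone x ≡ left → zone y ≡ right → ¬ (x ~ y))
      (P-right : ∀ {x} → x ∈ U → P x → zone x ≡ right → P′ x × (∀ {y} → y ∈ U → zone y ≢ middle))
      (Q-not-left  : ∀ {x} → x ∈ U → Q x → zone x ≢ left)
      (left~middle : ∀ {x y} → x ∈ U → y ∈ U → zone x ≡ left → zone y ≡ middle → x ~ y → Q′ x)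
      (middle~right : ∀ {x y} → x ∈ U → y ∈ U → zone x ≡ middle → zone y ≡ right → x ~ y → P′ y)
      (ΛL : Layout UL P Q′) (ΛR : Layout UR P′ Q)
      where

      private
        module L = Layout ΛL
        module R = Layout ΛR

        zrank : Zone → V → ℕ
        zrank left   x = L.rank x
        zrank middle x = L.size
        zrank right  x = suc (L.size + R.rank x)

        rank : V → ℕ
        rank x = zrank (zone x) x

        Before : Zone → Zone → V → V → Set
        Before left   left   x y = L.rank x < L.rank y
        Before left   middle x y = ⊤
        Before left   right  x y = ⊤
        Before middle right  x y = ⊤
        Before right  right  x y = R.rank x < R.rank y
        Before _      _      x y = ⊥

        before′ : ∀ i j {x y} → x ∈ U → y ∈ U → zone x ≡ i → zone y ≡ j → zrank i x < zrank j y → Before i j x y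
        before′ left   left   x∈ y∈ ex ey p = p
        before′ left   middle x∈ y∈ ex ey p = tt
        before′ left   right  x∈ y∈ ex ey p = tt
        before′ middle left   x∈ y∈ ex ey p = ℕ.<-asym p (L.rank<size (in-left y∈ ey))
        before′ middle middle x∈ y∈ ex ey p = ℕ.<-irrefl refl p
        before′ middle right  x∈ y∈ ex ey p = tt
        before′ right  left   x∈ y∈ ex ey p = ℕ.<-asym (ℕ.<-trans (s≤s (ℕ.m≤m+n L.size _)) p) (L.rank<size (in-left y∈ ey))
        before′ right  middle x∈ y∈ ex ey p = ℕ.<-asym p (s≤s (ℕ.m≤m+n L.size _))
        before′ right  right  x∈ y∈ ex ey (s≤s p) = ℕ.+-cancelˡ-< L.size _ _ p

        before : ∀ {x y} → x ∈ U → y ∈ U → rank x < rank y → Before (zone x) (zone y) x y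
        before x∈ y∈ = before′ _ _ x∈ y∈ refl refl

        rank<size′ : ∀ i {x} → x ∈ U → zone x ≡ i → zrank i x < suc (L.size + R.size)
        rank<size′ left   x∈ e = ℕ.<-≤-trans (L.rank<size (in-left x∈ e)) (ℕ.m≤n⇒m≤1+n (ℕ.m≤m+n L.size R.size))
        rank<size′ middle x∈ e = s≤s (ℕ.m≤m+n L.size R.size)
        rank<size′ right  x∈ e = s≤s (ℕ.+-monoʳ-< L.size (R.rank<size (in-right x∈ e)))

        injective′ : ∀ i j {x y} → x ∈ U → y ∈ U → zone x ≡ i → zone y ≡ j → zrank i x ≡ zrank j y → x ≡ y
        injective′ left   left   x∈ y∈ ex ey e = L.injective (in-left x∈ ex) (in-left y∈ ey) e
        injective′ left   middle x∈ y∈ ex ey e = contradiction e (ℕ.<⇒≢ (L.rank<size (in-left x∈ ex)))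
        injective′ left   right  x∈ y∈ ex ey e = contradiction e
          (ℕ.<⇒≢ (ℕ.<-trans (L.rank<size (in-left x∈ ex)) (s≤s (ℕ.m≤m+n L.size _))))
        injective′ middle left   x∈ y∈ ex ey e = contradiction (sym e) (ℕ.<⇒≢ (L.rank<size (in-left y∈ ey)))
        injective′ middle middle x∈ y∈ ex ey e = middle-unique x∈ y∈ ex ey
        injective′ middle right  x∈ y∈ ex ey e = contradiction e (ℕ.<⇒≢ (s≤s (ℕ.m≤m+n L.size _)))
        injective′ right  left   x∈ y∈ ex ey e = contradiction (sym e)
          (ℕ.<⇒≢ (ℕ.<-trans (L.rank<size (in-left y∈ ey)) (s≤s (ℕ.m≤m+n L.size _))))
        injective′ right  middle x∈ y∈ ex ey e = contradiction (sym e) (ℕ.<⇒≢ (s≤s (ℕ.m≤m+n L.size _)))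
        injective′ right  right  x∈ y∈ ex ey e =
          R.injective (in-right x∈ ex) (in-right y∈ ey) (ℕ.+-cancelˡ-≡ L.size _ _ (ℕ.suc-injective e))

        -- Zones can only increase along x, z, y, w, with the middle occurring at most once; for all
        -- other combinations `Before` is empty. An edge between a side and the middle vertex is an
        -- edge to an imaginary vertex of that side, so a crossing with it violates visibility
        -- there.
        noncrossing′ : ∀ i j k l {x z y w} → x ∈ U → y ∈ U → z ∈ U → w ∈ U → x ~ y → z ~ w →
          zone x ≡ i → zone z ≡ j → zone y ≡ k → zone w ≡ l →
          Before i j x z → Before j k z y → Before k l y w → ⊥
        noncrossing′ left left left left x∈ y∈ z∈ w∈ x~y z~w ex ez ey ew p q r =
          L.noncrossing (in-left x∈ ex) (in-left y∈ ey) (in-left z∈ ez) (in-left w∈ ew) x~y z~w p q r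
        noncrossing′ left left left middle x∈ y∈ z∈ w∈ x~y z~w ex ez ey ew p q r =
          L.Q-visible (in-left z∈ ez) (in-left x∈ ex) (in-left y∈ ey) (left~middle z∈ w∈ ez ew z~w) x~y p q
        noncrossing′ left left left right x∈ y∈ z∈ w∈ x~y z~w ex ez ey ew p q r = left≁right z∈ w∈ ez ew z~w
        noncrossing′ left left middle right x∈ y∈ z∈ w∈ x~y z~w ex ez ey ew p q r = left≁right z∈ w∈ ez ew z~w
        noncrossing′ left left right right x∈ y∈ z∈ w∈ x~y z~w ex ez ey ew p q r = left≁right x∈ y∈ ex ey x~y
        noncrossing′ left middle right right x∈ y∈ z∈ w∈ x~y z~w ex ez ey ew p q r = left≁right x∈ y∈ ex ey x~y
        noncrossing′ left right right right x∈ y∈ z∈ w∈ x~y z~w ex ez ey ew p q r = left≁right x∈ y∈ ex ey x~y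
        noncrossing′ middle right right right x∈ y∈ z∈ w∈ x~y z~w ex ez ey ew p q r =
          R.P-visible (in-right y∈ ey) (in-right z∈ ez) (in-right w∈ ew) (middle~right x∈ y∈ ex ey x~y) z~w q r
        noncrossing′ right right right right x∈ y∈ z∈ w∈ x~y z~w ex ez ey ew p q r =
          R.noncrossing (in-right x∈ ex) (in-right y∈ ey) (in-right z∈ ez) (in-right w∈ ew) x~y z~w p q r

        P-visible′ : ∀ i j k {y x z} → x ∈ U → y ∈ U → z ∈ U → P x → y ~ z →
          zone y ≡ i → zone x ≡ j → zone z ≡ k → Before i j y x → Before j k x z → ⊥
        P-visible′ left left left x∈ y∈ z∈ px y~z ey ex ez p q =
          L.P-visible (in-left x∈ ex) (in-left y∈ ey) (in-left z∈ ez) px y~z p q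
        -- Here both edges lead from the left part to its imaginary vertices, x to the first and y
        -- to the last, so the two may not pass each other.
        P-visible′ left left middle x∈ y∈ z∈ px y~z ey ex ez p q =
          L.P≤Q (in-left x∈ ex) (in-left y∈ ey) px (left~middle y∈ z∈ ey ez y~z) p
        P-visible′ left left right x∈ y∈ z∈ px y~z ey ex ez p q = left≁right y∈ z∈ ey ez y~z
        P-visible′ left middle right x∈ y∈ z∈ px y~z ey ex ez p q = left≁right y∈ z∈ ey ez y~z
        P-visible′ left right right x∈ y∈ z∈ px y~z ey ex ez p q = left≁right y∈ z∈ ey ez y~z
        P-visible′ middle right right x∈ y∈ z∈ px y~z ey ex ez p q = proj₂ (P-right x∈ px ex) y∈ ey
        P-visible′ right right right x∈ y∈ z∈ px y~z ey ex ez p q =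
          R.P-visible (in-right x∈ ex) (in-right y∈ ey) (in-right z∈ ez) (proj₁ (P-right x∈ px ex)) y~z p q

        Q-visible′ : ∀ i j k {y x z} → x ∈ U → y ∈ U → z ∈ U → Q x → y ~ z →
          zone y ≡ i → zone x ≡ j → zone z ≡ k → Before i j y x → Before j k x z → ⊥
        Q-visible′ i left k x∈ y∈ z∈ qx y~z ey ex ez p q = Q-not-left x∈ qx ex
        Q-visible′ left middle right x∈ y∈ z∈ qx y~z ey ex ez p q = left≁right y∈ z∈ ey ez y~z
        Q-visible′ left right right x∈ y∈ z∈ qx y~z ey ex ez p q = left≁right y∈ z∈ ey ez y~z
        -- The mirror image: in the right part, z is joined to the imaginary first vertex and x to
        -- the last.
        Q-visible′ middle right right x∈ y∈ z∈ qx y~z ey ex ez p q =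
          R.P≤Q (in-right z∈ ez) (in-right x∈ ex) (middle~right y∈ z∈ ey ez y~z) qx q
        Q-visible′ right right right x∈ y∈ z∈ qx y~z ey ex ez p q =
          R.Q-visible (in-right x∈ ex) (in-right y∈ ey) (in-right z∈ ez) qx y~z p q

        P≤Q′ : ∀ i j {x y} → x ∈ U → y ∈ U → P x → Q y → zone y ≡ i → zone x ≡ j → Before i j y x → ⊥
        P≤Q′ left   j     x∈ y∈ px qy ey ex p = Q-not-left y∈ qy ey
        P≤Q′ middle right x∈ y∈ px qy ey ex p = proj₂ (P-right x∈ px ex) y∈ ey
        P≤Q′ right  right x∈ y∈ px qy ey ex p = R.P≤Q (in-right x∈ ex) (in-right y∈ ey) (proj₁ (P-right x∈ px ex)) qy p

      join-layouts : Layout U P Q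
      join-layouts = record
        { rank        = rank
        ; size        = suc (L.size + R.size)
        ; rank<size   = λ x∈ → rank<size′ _ x∈ refl
        ; injective   = λ x∈ y∈ → injective′ _ _ x∈ y∈ refl refl
        ; noncrossing = λ x∈ y∈ z∈ w∈ x~y z~w p q r → noncrossing′ _ _ _ _ x∈ y∈ z∈ w∈ x~y z~w refl refl refl refl
                          (before x∈ z∈ p) (before z∈ y∈ q) (before y∈ w∈ r)
        ; P-visible   = λ x∈ y∈ z∈ px y~z p q → P-visible′ _ _ _ x∈ y∈ z∈ px y~z refl refl refl (before y∈ x∈ p) (before x∈ z∈ q)
        ; Q-visible   = λ x∈ y∈ z∈ qx y~z p q → Q-visible′ _ _ _ x∈ y∈ z∈ qx y~z refl refl refl (before y∈ x∈ p) (before x∈ z∈ q)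
        ; P≤Q         = λ x∈ y∈ px qy p → P≤Q′ _ _ x∈ y∈ px qy refl refl (before y∈ x∈ p)
        }

  -- The induction on the vertex set.

  xor≡false⇒≡ : ∀ {x y} → x xor y ≡ false → x ≡ y
  xor≡false⇒≡ {true}  {true}  refl = refl
  xor≡false⇒≡ {false} {false} refl = refl

  module _ {n} (G : Graph n) where
    open Graph G

    private V = Fin n

    _∈?_ : (x : V) (U : List V) → Dec (x ∈ U)
    _∈?_ = DecMembership._∈?_ Fin._≟_

    -- This is `EvenlyCrossing` for the edges at an imaginary first vertex s and last vertex t,
    -- where σ s x and σ x t are true for all x. The fields come from the pairs of edges sx and yz,
    -- xt and yz, sx and yt.
    record Admissible (U : List V) (P Q : Pred V 0ℓ) (σ : V → V → Bool) : Set where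
      field
        P-even     : ∀ {x y z} → x ∈ U → y ∈ U → z ∈ U → P x → y ~ z → x ≢ y → x ≢ z → σ x y ≡ σ x z
        Q-even     : ∀ {x y z} → x ∈ U → y ∈ U → z ∈ U → Q x → y ~ z → x ≢ y → x ≢ z → σ x y ≡ σ x z
        P-before-Q : ∀ {x y} → x ∈ U → y ∈ U → P x → Q y → x ≢ y → σ x y ≡ true

    -- The induction hypothesis. It ranges over `σ`, `P` and `Q`, since cutting changes the
    -- predicates and `free-layout` also changes `σ`.
    Recursive : List V → Set₁
    Recursive U = ∀ U′ → length U′ < length U → ∀ {P Q} → Decidable P → Decidable Q → ∀ σ →
                  IsTournament σ → EvenlyCrossing G σ → Admissible U′ P Q σ → Layout G U′ P Q

    empty-layout : ∀ {P Q} → Layout G [] P Q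
    empty-layout = record
      { rank = λ _ → 0 ; size = 0 ; rank<size = λ () ; injective = λ () ; noncrossing = λ ()
      ; P-visible = λ () ; Q-visible = λ () ; P≤Q = λ () }

    star-even : ∀ {σ} → EvenlyCrossing G σ → ∀ {m x y z} → x ~ m → y ~ z → σ m y ≡ σ m z →
                x ≢ y → x ≢ z → m ≢ y → m ≢ z → σ x y ≡ σ x z
    star-even {σ} even {m} {x} {y} {z} x~m y~z e x≢y x≢z m≢y m≢z = xor≡false⇒≡ (begin
      σ x y xor σ x z                        ≡⟨ sym (𝔹.xor-identityʳ _) ⟩
      (σ x y xor σ x z) xor false            ≡⟨ cong ((σ x y xor σ x z) xor_) (sym (trans (cong (_xor σ m z) e) (𝔹.xor-same (σ m z)))) ⟩
      (σ x y xor σ x z) xor (σ m y xor σ m z) ≡⟨ even x~m y~z x≢y x≢z m≢y m≢z ⟩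
      false                                  ∎)
      where open ≡-Reasoning

    module _ {U : List V} {P Q : Pred V 0ℓ} (P? : Decidable P) (Q? : Decidable Q) {σ : V → V → Bool}
      (tour : IsTournament σ) (even : EvenlyCrossing G σ) (adm : Admissible U P Q σ) (rec : Recursive U) where
      open Admissible adm

      flipped : ∀ {x y} → x ≢ y → σ x y ≡ true → σ y x ≡ false
      flipped {x} {y} x≢y e = trans (tour y x (x≢y ∘ sym)) (cong not e)

      unflipped : ∀ {x y} → x ≢ y → σ x y ≡ false → σ y x ≡ true
      unflipped {x} {y} x≢y e = trans (tour y x (x≢y ∘ sym)) (cong not e)

      -- The edge from the imaginary first vertex to its last neighbour m separates
      -- the vertices before m from those after m.
      split-layout : ∀ {m} → m ∈ U → P m → (∀ {x} → x ∈ U → P x → x ≢ m → σ m x ≢ true) → Layout G U P Q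
      split-layout {m} m∈ pm last = join-layouts G zone
        (λ x∈ e → ∈-filter⁺ left? x∈ e) (λ x∈ e → ∈-filter⁺ right? x∈ e)
        (λ _ _ ex ey → trans (zone-middle ex) (sym (zone-middle ey)))
        -- By `P-even` at m, the two ends of an edge that avoids m lie on the same side of m.
        (λ x∈ y∈ ex ey x~y → contradiction
          (trans (sym (proj₂ (zone-right ey))) (trans (sym (P-even m∈ x∈ y∈ pm x~y (proj₁ (zone-left ex) ∘ sym) (proj₁ (zone-right ey) ∘ sym))) (proj₂ (zone-left ex)))) λ ())
        (λ x∈ px e → ⊥-elim (last x∈ px (proj₁ (zone-right e)) (proj₂ (zone-right e))))
        -- Neighbours of the imaginary last vertex, other than m itself, come after m by
        -- `P-before-Q`.
        (λ x∈ qx e → contradiction (trans (sym (P-before-Q m∈ x∈ pm qx (proj₁ (zone-left e) ∘ sym))) (proj₂ (zone-left e))) λ ())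
        (λ {x} _ _ _ ey x~y → subst (x ~_) (zone-middle ey) x~y)
        (λ {x} {y} _ _ ex _ x~y → subst (y ~_) (zone-middle ex) (~-sym x~y))
        (rec (filter left? U) (filter-shorter left? U m∈ λ e → proj₁ (zone-left e) refl) P? (_~? m) σ tour even left-adm)
        (rec (filter right? U) (filter-shorter right? U m∈ λ e → proj₁ (zone-right e) refl) (_~? m) Q? σ tour even right-adm)
        where
        zone : V → Zone
        zone x with x Fin.≟ m | σ m x
        ... | yes _ | _     = middle
        ... | no _  | false = left
        ... | no _  | true  = right
        zone-left : ∀ {x} → zone x ≡ left → x ≢ m × σ m x ≡ false
        zone-left {x} e with x Fin.≟ m | σ m x
        ... | no x≢m | false = x≢m , refl
        zone-right : ∀ {x} → zone x ≡ right → x ≢ m × σ m x ≡ true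
        zone-right {x} e with x Fin.≟ m | σ m x
        ... | no x≢m | true = x≢m , refl
        zone-middle : ∀ {x} → zone x ≡ middle → x ≡ m
        zone-middle {x} e with x Fin.≟ m | σ m x
        ... | yes x≡m | _ = x≡m
        ... | no _ | false = contradiction e λ ()
        ... | no _ | true  = contradiction e λ ()
        left? : Decidable (λ x → zone x ≡ left)
        left? x = zone x ≟ᶻ left
        right? : Decidable (λ x → zone x ≡ right)
        right? x = zone x ≟ᶻ right
        fromᴸ : ∀ {x} → x ∈ filter left? U → x ∈ U × (x ≢ m × σ m x ≡ false)
        fromᴸ x∈ with x∈U , e ← ∈-filter⁻ left? {xs = U} x∈ = x∈U , zone-left e
        fromᴿ : ∀ {x} → x ∈ filter right? U → x ∈ U × (x ≢ m × σ m x ≡ true)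
        fromᴿ x∈ with x∈U , e ← ∈-filter⁻ right? {xs = U} x∈ = x∈U , zone-right e
        left-adm : Admissible (filter left? U) P (_~ m) σ
        left-adm = record
          { P-even = λ x∈ y∈ z∈ → P-even (proj₁ (fromᴸ x∈)) (proj₁ (fromᴸ y∈)) (proj₁ (fromᴸ z∈))
          ; Q-even = λ x∈ y∈ z∈ x~m y~z x≢y x≢z → let (_ , y≢m , my) = fromᴸ y∈ ; (_ , z≢m , mz) = fromᴸ z∈ in
              star-even even x~m y~z (trans my (sym mz)) x≢y x≢z (y≢m ∘ sym) (z≢m ∘ sym)
          -- Applied at x to the edge ym, `P-even` carries the known value of σ x m over to σ x y.
          ; P-before-Q = λ x∈ y∈ px y~m x≢y → let (x∈U , x≢m , mx) = fromᴸ x∈ in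
              trans (P-even x∈U (proj₁ (fromᴸ y∈)) m∈ px y~m x≢y x≢m) (unflipped (x≢m ∘ sym) mx)
          }
        right-adm : Admissible (filter right? U) (_~ m) Q σ
        right-adm = record
          { P-even = λ x∈ y∈ z∈ x~m y~z x≢y x≢z → let (_ , y≢m , my) = fromᴿ y∈ ; (_ , z≢m , mz) = fromᴿ z∈ in
              star-even even x~m y~z (trans my (sym mz)) x≢y x≢z (y≢m ∘ sym) (z≢m ∘ sym)
          ; Q-even = λ x∈ y∈ z∈ → Q-even (proj₁ (fromᴿ x∈)) (proj₁ (fromᴿ y∈)) (proj₁ (fromᴿ z∈))
          ; P-before-Q = λ x∈ y∈ x~m qy x≢y → let (y∈U , y≢m , my) = fromᴿ y∈ in
              unflipped (x≢y ∘ sym)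
                (trans (Q-even y∈U (proj₁ (fromᴿ x∈)) m∈ qy x~m (x≢y ∘ sym) y≢m) (flipped (y≢m ∘ sym) my))
          }

      module _ (m : V) where
        After : Pred V 0ℓ
        After x = x ≢ m × σ m x ≡ true
        after? : Decidable After
        after? x = ¬? (x Fin.≟ m) ×-dec (σ m x 𝔹.≟ true)

      restrict : ∀ {R : Pred V 0ℓ} {R? : Decidable R} {P′ Q′} →
        (∀ {x} → x ∈ filter R? U → P′ x → P x) → (∀ {x} → x ∈ filter R? U → Q′ x → Q x) → Admissible (filter R? U) P′ Q′ σ
      restrict {R} {R?} P′⊆P Q′⊆Q = record
        { P-even = λ x∈ y∈ z∈ px → P-even (inU x∈) (inU y∈) (inU z∈) (P′⊆P x∈ px)
        ; Q-even = λ x∈ y∈ z∈ qx → Q-even (inU x∈) (inU y∈) (inU z∈) (Q′⊆Q x∈ qx)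
        ; P-before-Q = λ x∈ y∈ px qy → P-before-Q (inU x∈) (inU y∈) (P′⊆P x∈ px) (Q′⊆Q y∈ qy)
        }
        where
        inU : ∀ {x} → x ∈ filter R? U → x ∈ U
        inU x∈ = proj₁ (∈-filter⁻ R? {xs = U} x∈)

      -- The vertices after m′ but not after m form a union of components.
      glue-layout : ∀ {m m′} → m ∈ U → m′ ∈ U → P m → P m′ → m′ ≢ m → σ m m′ ≡ true →
                    length (filter (after? m) U) ≤ length (filter (after? m′) U) → Layout G U P Q
      glue-layout {m} {m′} m∈ m′∈ pm pm′ m′≢m mm′ minimal = glue (any? S? U)
        where
        S : Pred V 0ℓ
        S x = After m′ x × ¬ After m x
        S? : Decidable S
        S? x = after? m′ x ×-dec ¬? (after? m x)
        zone : V → Zone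
        zone x with S? x
        ... | yes _ = left
        ... | no _  = right
        zone≢middle : ∀ x → zone x ≢ middle
        zone≢middle x e with S? x
        ... | yes _ = contradiction e λ ()
        ... | no _  = contradiction e λ ()
        zone-left : ∀ {x} → zone x ≡ left → S x
        zone-left {x} e with S? x
        ... | yes s = s
        zone-right : ∀ {x} → zone x ≡ right → ¬ S x
        zone-right {x} e with S? x
        ... | no ¬s = ¬s
        left? : Decidable (λ x → zone x ≡ left)
        left? x = zone x ≟ᶻ left
        right? : Decidable (λ x → zone x ≡ right)
        right? x = zone x ≟ᶻ right
        m∉S : ¬ S m
        m∉S ((_ , m′m) , _) = contradiction (trans (sym (flipped (m′≢m ∘ sym) mm′)) m′m) λ ()
        -- Both σ m and σ m′ are constant along edges that avoid m and m′. An edge from S cannot end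
        -- in m′, which is after m while x is not, nor in m, which is not after m′.
        closed : ∀ {x y} → x ∈ U → y ∈ U → S x → x ~ y → S y
        closed {x} {y} x∈ y∈ ((x≢m′ , m′x) , ¬mx) x~y = (y≢m′ , m′y) , λ (_ , my) → ¬mx (x≢m , trans (mx≡my y≢m) my)
          where
          x≢m : x ≢ m
          x≢m refl = contradiction (trans (sym (flipped (m′≢m ∘ sym) mm′)) m′x) λ ()
          mx≡my : y ≢ m → σ m x ≡ σ m y
          mx≡my y≢m = P-even m∈ x∈ y∈ pm x~y (x≢m ∘ sym) (y≢m ∘ sym)
          y≢m′ : y ≢ m′
          y≢m′ refl = ¬mx (x≢m , trans (mx≡my m′≢m) mm′)
          m′y : σ m′ y ≡ true
          m′y = trans (sym (P-even m′∈ x∈ y∈ pm′ x~y (x≢m′ ∘ sym) (y≢m′ ∘ sym))) m′x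
          y≢m : y ≢ m
          y≢m refl = contradiction (trans (sym (flipped (m′≢m ∘ sym) mm′)) m′y) λ ()
        S-not-Q : ∀ {x} → x ∈ U → Q x → ¬ S x
        S-not-Q {x} x∈ qx s@(_ , ¬mx) with x Fin.≟ m
        ... | yes refl = m∉S s
        ... | no x≢m = ¬mx (x≢m , P-before-Q m∈ x∈ pm qx (x≢m ∘ sym))
        glue : Dec (Any S U) → Layout G U P Q
        -- If S missed U, all vertices of U after m′ would be after m. As m′ itself is after m but
        -- not after m′, fewer vertices would follow m′ than m.
        glue (no none) = contradiction minimal (ℕ.<⇒≱ (length-filter-mono-< (after? m′) (after? m) U
          after⊆ m′∈ (λ (m′≢m′ , _) → m′≢m′ refl) (m′≢m , mm′)))
          where
          after⊆ : ∀ {x} → x ∈ U → After m′ x → After m x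
          after⊆ {x} x∈ ax with after? m x
          ... | yes h = h
          ... | no ¬h = contradiction (lose x∈ (ax , ¬h)) none
        -- The components in S contain no neighbour of the imaginary last vertex, so they may stand
        -- in front of everything else. They keep `P` and get an empty `Q′`.
        glue (yes some) = join-layouts G zone
          (λ x∈ e → ∈-filter⁺ left? x∈ e) (λ x∈ e → ∈-filter⁺ right? x∈ e)
          (λ {x} _ _ ex _ → contradiction ex (zone≢middle x))
          (λ x∈ y∈ ex ey x~y → zone-right ey (closed x∈ y∈ (zone-left ex) x~y))
          (λ _ px _ → px , λ {y} _ → zone≢middle y)
          (λ x∈ qx e → S-not-Q x∈ qx (zone-left e))
          (λ {_} {y} _ _ _ ey _ → ⊥-elim (zone≢middle y ey))
          (λ {x} _ _ ex _ _ → ⊥-elim (zone≢middle x ex))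
          (rec (filter left? U) (filter-shorter left? U m∈ λ e → m∉S (zone-left e)) P? (λ _ → no id) σ tour even
            (restrict {R? = left?} (λ _ px → px) (λ _ ())))
          (let (s , s∈ , Ss) = find some in
           rec (filter right? U) (filter-shorter right? U s∈ λ e → zone-right e Ss) P? Q? σ tour even
            (restrict {R? = right?} (λ _ px → px) (λ _ qx → qx)))

      -- Choosing m with the fewest later vertices picks the last neighbour of the imaginary first
      -- vertex if σ is transitive. A neighbour m′ still later than m witnesses a failure of
      -- transitivity, and then components can be split off.
      P-layout : Any P U → Layout G U P Q
      P-layout some
        with (x , x∈ , px) ← find some
        with (m , (m∈ , pm) , minimal) ← least (λ m → length (filter (after? m) U)) (λ x → (x ∈? U) ×-dec P? x) (x , x∈ , px)
        with any? (λ x → P? x ×-dec after? m x) U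
      ... | no none = split-layout m∈ pm λ x∈ px x≢m mx → none (lose x∈ (px , x≢m , mx))
      ... | yes later = let (m′ , m′∈ , pm′ , m′≢m , mm′) = find later in
        glue-layout m∈ m′∈ pm pm′ m′≢m mm′ (minimal m′ (m′∈ , pm′))

    -- The order is kept: the conditions on `P` and on `Q` have the same form, and `P-before-Q` is
    -- vacuous when `P` has no vertex in `U`.
    reverse-admissible : ∀ {U P Q σ} → ¬ Any P U → Admissible U P Q σ → Admissible U Q P σ
    reverse-admissible ¬P adm = record
      { P-even = Q-even ; Q-even = P-even ; P-before-Q = λ _ y∈ _ py → contradiction (lose y∈ py) ¬P }
      where open Admissible adm

    reverse-layout : ∀ {U P Q} → ¬ Any P U → Layout G U Q P → Layout G U P Q
    reverse-layout ¬P Λ = record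
      { rank = rank ; size = size ; rank<size = rank<size ; injective = injective ; noncrossing = noncrossing
      ; P-visible = Q-visible ; Q-visible = P-visible ; P≤Q = λ x∈ _ px → contradiction (lose x∈ px) ¬P }
      where open Layout Λ

    -- Switching σ at every vertex that precedes m makes m the first vertex.
    module _ {σ : V → V → Bool} (tour : IsTournament σ) (even : EvenlyCrossing G σ) (m : V) where

      switch : V → V → Bool
      switch x y = σ x y xor (σ m x xor σ m y)

      switch-tournament : IsTournament switch
      switch-tournament x y x≢y = trans (cong₂ _xor_ (tour x y x≢y) (𝔹.xor-comm (σ m x) (σ m y)))
        (sym (𝔹.not-distribˡ-xor (σ y x) (σ m y xor σ m x)))

      -- Each vertex of the two edges occurs in two of the four summands, so the switching terms
      -- cancel.
      switch-evenlyCrossing : EvenlyCrossing G switch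
      switch-evenlyCrossing {a} {b} {c} {d} a~b c~d a≢c a≢d b≢c b≢d = trans
        (lem (σ a c) (σ a d) (σ b c) (σ b d) (σ m a) (σ m b) (σ m c) (σ m d)) (even a~b c~d a≢c a≢d b≢c b≢d)
        where
        open xor-∧-Solver
        lem : ∀ ac ad bc bd a b c d →
          ((ac xor (a xor c)) xor (ad xor (a xor d))) xor ((bc xor (b xor c)) xor (bd xor (b xor d))) ≡ (ac xor ad) xor (bc xor bd)
        lem = solve 8 (λ ac ad bc bd a b c d →
          ((ac :+ (a :+ c)) :+ (ad :+ (a :+ d))) :+ ((bc :+ (b :+ c)) :+ (bd :+ (b :+ d))) := (ac :+ ad) :+ (bc :+ bd)) refl

      -- The switching terms at y and z are exactly what the crossing condition for the edges xm and
      -- yz contributes at m.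
      switch-star : ∀ {x y z} → x ~ m → y ~ z → x ≢ y → x ≢ z → m ≢ y → m ≢ z → switch x y ≡ switch x z
      switch-star {x} {y} {z} x~m y~z x≢y x≢z m≢y m≢z = xor≡false⇒≡ (trans
        (lem (σ x y) (σ x z) (σ m x) (σ m y) (σ m z)) (even x~m y~z x≢y x≢z m≢y m≢z))
        where
        open xor-∧-Solver
        lem : ∀ xy xz mx my mz → (xy xor (mx xor my)) xor (xz xor (mx xor mz)) ≡ (xy xor xz) xor (my xor mz)
        lem = solve 5 (λ xy xz mx my mz → (xy :+ (mx :+ my)) :+ (xz :+ (mx :+ mz)) := (xy :+ xz) :+ (my :+ mz)) refl

    -- With no imaginary edges to respect, an arbitrary vertex m can be placed first and becomes the
    -- imaginary first vertex of the rest. Switching makes its neighbourhood admissible as `P`. The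
    -- left zone stays empty.
    free-layout : ∀ {U P Q} → Decidable Q → ¬ Any P U → ¬ Any Q U → ∀ {σ} → IsTournament σ → EvenlyCrossing G σ → Recursive U →
                  ∀ {m} → m ∈ U → Layout G U P Q
    free-layout {U} {Q = Q} Q? ¬P ¬Q tour even rec {m} m∈ = join-layouts G {UL = []} {P′ = _~ m} {Q′ = λ _ → ⊤} zone
      (λ {x} _ e → contradiction e (zone≢left x)) (λ x∈ e → ∈-filter⁺ right? x∈ e)
      (λ _ _ ex ey → trans (zone-middle ex) (sym (zone-middle ey)))
      (λ {x} _ _ ex _ _ → zone≢left x ex)
      (λ x∈ px _ → contradiction (lose x∈ px) ¬P)
      (λ x∈ qx _ → ¬Q (lose x∈ qx))
      _
      (λ {x} {y} _ _ ex _ x~y → subst (y ~_) (zone-middle ex) (~-sym x~y))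
      empty-layout
      (rec (filter right? U) (filter-shorter right? U m∈ λ e → zone-right e refl) (_~? m) Q?
        (switch tour even m) (switch-tournament tour even m) (switch-evenlyCrossing tour even m) (record
          { P-even = λ x∈ y∈ z∈ x~m y~z x≢y x≢z → switch-star tour even m x~m y~z x≢y x≢z (≢m y∈ ∘ sym) (≢m z∈ ∘ sym)
          ; Q-even = λ x∈ _ _ qx → contradiction qx (no-Q x∈)
          ; P-before-Q = λ _ y∈ _ qy → contradiction qy (no-Q y∈) }))
      where
      zone : V → Zone
      zone x with x Fin.≟ m
      ... | yes _ = middle
      ... | no _  = right
      zone≢left : ∀ x → zone x ≢ left
      zone≢left x e with x Fin.≟ m
      ... | yes _ = contradiction e λ ()
      ... | no _  = contradiction e λ ()
      zone-middle : ∀ {x} → zone x ≡ middle → x ≡ m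
      zone-middle {x} e with x Fin.≟ m
      ... | yes x≡m = x≡m
      ... | no _    = contradiction e λ ()
      zone-right : ∀ {x} → zone x ≡ right → x ≢ m
      zone-right {x} e with x Fin.≟ m
      ... | no x≢m = x≢m
      right? : Decidable (λ x → zone x ≡ right)
      right? x = zone x ≟ᶻ right
      no-Q : ∀ {x} → x ∈ filter right? U → ¬ Q x
      no-Q x∈ qx = ¬Q (lose (proj₁ (∈-filter⁻ right? {xs = U} x∈)) qx)
      ≢m : ∀ {x} → x ∈ filter right? U → x ≢ m
      ≢m x∈ = zone-right (proj₂ (∈-filter⁻ right? {xs = U} x∈))

    layout : ∀ k U → length U < k → ∀ {P Q} → Decidable P → Decidable Q → ∀ σ →
             IsTournament σ → EvenlyCrossing G σ → Admissible U P Q σ → Layout G U P Q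
    layout (suc k) [] _ _ _ _ _ _ _ = empty-layout
    layout (suc k) U@(u ∷ _) (s≤s ∣U∣≤k) P? Q? σ tour even adm with any? P? U | any? Q? U
    ... | yes some | _ = P-layout P? Q? tour even adm rec some
      where
      rec : Recursive U
      rec U′ U′<U = layout k U′ (ℕ.<-≤-trans U′<U ∣U∣≤k)
    ... | no ¬P | yes some = reverse-layout ¬P (P-layout Q? P? tour even (reverse-admissible ¬P adm) rec some)
      where
      rec : Recursive U
      rec U′ U′<U = layout k U′ (ℕ.<-≤-trans U′<U ∣U∣≤k)
    ... | no ¬P | no ¬Q = free-layout Q? ¬P ¬Q tour even rec (here refl)
      where
      rec : Recursive U
      rec U′ U′<U = layout k U′ (ℕ.<-≤-trans U′<U ∣U∣≤k)

  record NoncrossingOrder {n} (G : Graph n) : Set where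
    open Graph G
    field
      rank        : Fin n → ℕ
      size        : ℕ
      rank<size   : ∀ x → rank x < size
      injective   : ∀ {x y} → rank x ≡ rank y → x ≡ y
      noncrossing : ∀ {x y z w} → x ~ y → z ~ w → rank x < rank z → rank z < rank y → ¬ (rank y < rank w)

  noncrossing-order : ∀ {n} {G : Graph n} {σ} → IsTournament σ → EvenlyCrossing G σ → NoncrossingOrder G
  noncrossing-order {n} {G} {σ} tour even = record
    { rank        = rank
    ; size        = size
    ; rank<size   = λ x → rank<size (∈-allFin x)
    ; injective   = injective (∈-allFin _) (∈-allFin _)
    ; noncrossing = noncrossing (∈-allFin _) (∈-allFin _) (∈-allFin _) (∈-allFin _)
    }
    where
    trivially-admissible : Admissible G (allFin n) (λ _ → ⊥) (λ _ → ⊥) σ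
    trivially-admissible = record { P-even = λ _ _ _ () ; Q-even = λ _ _ _ () ; P-before-Q = λ _ _ () }
    Λ : Layout G (allFin n) (λ _ → ⊥) (λ _ → ⊥)
    Λ = layout G _ (allFin n) ℕ.≤-refl (λ _ → no id) (λ _ → no id) σ tour even trivially-admissible
    open Layout Λ

open LinearLayout

-- Outerplanar drawings from noncrossing orders.

module ParabolaDrawing where

  open import Data.Rational using (_+_; _*_; _-_; -_; _<_) renaming (_≤_ to _≤ℚ_)

  0≤x*x : ∀ x → 0ℚ ≤ℚ x * x
  0≤x*x x = [ (λ 0≤x → 0≤* 0≤x 0≤x) , (λ x≤0 → subst (0ℚ ≤ℚ_) (lem x) (0≤* (ℚ.neg-antimono-≤ x≤0) (ℚ.neg-antimono-≤ x≤0))) ]′ (ℚ.≤-total 0ℚ x)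
    where
    lem : ∀ x → - x * - x ≡ x * x
    lem = solve-∀ ringℚ

  0≤-⁻¹ : ∀ {x y} → 0ℚ ≤ℚ y - x → x ≤ℚ y
  0≤-⁻¹ {x} {y} h = subst₂ _≤ℚ_ (ℚ.+-identityˡ x) (lem x y) (ℚ.+-monoˡ-≤ x h)
    where
    lem : ∀ x y → y - x + x ≡ y
    lem = solve-∀ ringℚ

  parabola : ℚ → Point
  parabola x = x , x * x

  -- The secant minus the parabola is a quadratic with roots a and b and leading coefficient -1;
  -- `height` is its factorisation.
  record Chord (a b : ℚ) (p : Point) : Set where
    constructor chord
    field
      lower  : a ≤ℚ proj₁ p
      upper  : proj₁ p ≤ℚ b
      height : proj₂ p - proj₁ p * proj₁ p ≡ (proj₁ p - a) * (b - proj₁ p)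

  between⇒chord : ∀ {a b p} → a < b → p between (parabola a , parabola b) → Chord a b p
  between⇒chord {a} {b} {_ , _} a<b (t , 0≤t , t≤1 , refl , refl) = chord
    (0≤-⁻¹ (subst (0ℚ ≤ℚ_) (l a b t) (0≤* 0≤t 0≤b-a)))
    (0≤-⁻¹ (subst (0ℚ ≤ℚ_) (u a b t) (0≤* (0≤- t≤1) 0≤b-a)))
    (h a b t)
    where
    0≤b-a = ℚ.<⇒≤ (0<- a<b)
    l : ∀ a b t → t * (b - a) ≡ ((1ℚ - t) * a + t * b) - a
    l = solve-∀ ringℚ
    u : ∀ a b t → (1ℚ - t) * (b - a) ≡ b - ((1ℚ - t) * a + t * b)
    u = solve-∀ ringℚ
    h : ∀ a b t → (1ℚ - t) * (a * a) + t * (b * b) - ((1ℚ - t) * a + t * b) * ((1ℚ - t) * a + t * b) ≡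
        ((1ℚ - t) * a + t * b - a) * (b - ((1ℚ - t) * a + t * b))
    h = solve-∀ ringℚ

  difference-zero : ∀ {x y} → x - y ≡ 0ℚ → x ≡ y
  difference-zero {x} {y} e = trans (lem x y) (trans (cong (_+ y) e) (ℚ.+-identityˡ y))
    where
    lem : ∀ x y → x ≡ x - y + y
    lem = solve-∀ ringℚ

  chord-left : ∀ {a b p} → Chord a b p → proj₁ p ≡ a → p ≡ parabola a
  chord-left {a} {b} {_ , y} (chord _ _ h) refl = cong (a ,_) (difference-zero (trans h (lem a b)))
    where
    lem : ∀ a b → (a - a) * (b - a) ≡ 0ℚ
    lem = solve-∀ ringℚ

  chord-right : ∀ {a b p} → Chord a b p → proj₁ p ≡ b → p ≡ parabola b
  chord-right {a} {b} {_ , y} (chord _ _ h) refl = cong (b ,_) (difference-zero (trans h (lem a b)))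
    where
    lem : ∀ a b → (b - a) * (b - b) ≡ 0ℚ
    lem = solve-∀ ringℚ

  chord-above : ∀ {a b p} → Chord a b p → proj₁ p * proj₁ p ≤ℚ proj₂ p
  chord-above (chord l u h) = 0≤-⁻¹ (subst (0ℚ ≤ℚ_) (sym h) (0≤* (0≤- l) (0≤- u)))

  split-≤ : ∀ {x y} → x ≤ℚ y → x < y ⊎ x ≡ y
  split-≤ {x} {y} x≤y with ℚ.<-cmp x y
  ... | tri< p _ _ = inj₁ p
  ... | tri≈ _ e _ = inj₂ e
  ... | tri> _ _ p = ⊥-elim (ℚ.<-irrefl refl (ℚ.<-≤-trans p x≤y))

  chord-vertex : ∀ {a b x} → Chord a b (parabola x) → x ≡ a ⊎ x ≡ b
  chord-vertex {a} {b} {x} (chord l u h) with split-≤ l | split-≤ u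
  ... | inj₂ e | _ = inj₁ (sym e)
  ... | _ | inj₂ e = inj₂ e
  ... | inj₁ a<x | inj₁ x<b = contradiction (sym (trans (sym (ℚ.+-inverseʳ (x * x))) h)) (ℚ.<⇒≢ (0<* (0<- a<x) (0<- x<b)) ∘ sym)

  -- Strictly between c and d the outer chord is strictly higher: the difference of the two heights
  -- is (c - a)(b - s) + (s - c)(b - d).
  nested-chords : ∀ {a b c d p} → a ≤ℚ c → d ≤ℚ b → a < c ⊎ d < b → Chord a b p → Chord c d p → proj₁ p ≡ c ⊎ proj₁ p ≡ d
  nested-chords {a} {b} {c} {d} {s , y} a≤c d≤b strict (chord _ _ h) (chord l u k) with split-≤ l | split-≤ u
  ... | inj₂ e | _ = inj₁ (sym e)
  ... | _ | inj₂ e = inj₂ e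
  ... | inj₁ c<s | inj₁ s<d = contradiction (trans (sym (lem a b c d s)) (trans (cong₂ _-_ (sym h) (sym k)) (ℚ.+-inverseʳ (y - s * s))))
    (ℚ.<⇒≢ (gap strict) ∘ sym)
    where
    s<b = ℚ.<-≤-trans s<d d≤b
    lem : ∀ a b c d s → (s - a) * (b - s) - (s - c) * (d - s) ≡ (c - a) * (b - s) + (s - c) * (b - d)
    lem = solve-∀ ringℚ
    gap : a < c ⊎ d < b → 0ℚ < (c - a) * (b - s) + (s - c) * (b - d)
    gap (inj₁ a<c) = ℚ.+-mono-<-≤ (0<* (0<- a<c) (0<- s<b)) (0≤* (ℚ.<⇒≤ (0<- c<s)) (0≤- d≤b))
    gap (inj₂ d<b) = ℚ.+-mono-≤-< (0≤* (0≤- a≤c) (ℚ.<⇒≤ (0<- s<b))) (0<* (0<- c<s) (0<- d<b))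

  fromℕ : ℕ → ℚ
  fromℕ zero    = 0ℚ
  fromℕ (suc k) = 1ℚ + fromℕ k

  fromℕ-step : ∀ k → fromℕ k < fromℕ (suc k)
  fromℕ-step k = subst (_< 1ℚ + fromℕ k) (ℚ.+-identityˡ (fromℕ k)) (ℚ.+-monoˡ-< (fromℕ k) (ℚ.positive⁻¹ 1ℚ))

  fromℕ-mono-< : ∀ {k l} → k ℕ.< l → fromℕ k < fromℕ l
  fromℕ-mono-< {k} {suc l} (s≤s k≤l) with ℕ.m≤n⇒m<n∨m≡n k≤l
  ... | inj₁ k<l  = ℚ.<-trans (fromℕ-mono-< k<l) (fromℕ-step l)
  ... | inj₂ refl = fromℕ-step l

  fromℕ-mono-≤ : ∀ {k l} → k ℕ.≤ l → fromℕ k ≤ℚ fromℕ l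
  fromℕ-mono-≤ k≤l with ℕ.m≤n⇒m<n∨m≡n k≤l
  ... | inj₁ k<l  = ℚ.<⇒≤ (fromℕ-mono-< k<l)
  ... | inj₂ refl = ℚ.≤-refl

  fromℕ-injective : ∀ {k l} → fromℕ k ≡ fromℕ l → k ≡ l
  fromℕ-injective {k} {l} e with ℕ.<-cmp k l
  ... | tri< p _ _ = contradiction e (ℚ.<⇒≢ (fromℕ-mono-< p))
  ... | tri≈ _ k≡l _ = k≡l
  ... | tri> _ _ p = contradiction (sym e) (ℚ.<⇒≢ (fromℕ-mono-< p))

  module _ {n} {G : Graph n} (ord : NoncrossingOrder G) where
    open Graph G
    open NoncrossingOrder ord

    private
      X : Fin n → ℚ
      X v = fromℕ (rank v)

      vertex : Fin n → Point
      vertex v = parabola (X v)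

      SegmentCurve : Fin n → Fin n → Point → Set
      SegmentCurve u v = OnCurve (vertex u ∷ vertex v ∷ [])

      curve⇒between : ∀ {u v p} → SegmentCurve u v p → p between (vertex u , vertex v)
      curve⇒between (inj₁ on)   = on
      curve⇒between {u} {v} (inj₂ refl) = right-end (vertex u) (vertex v)

      ranks-differ : ∀ {u v} → u ~ v → rank u ≢ rank v
      ranks-differ u~v e with refl ← injective e = ~-irrefl u~v

      wlog : ∀ {u v} → u ~ v → (R : Fin n → Fin n → Set) → (∀ {x y} → R y x → R x y) →
             (∀ {x y} → x ~ y → rank x ℕ.< rank y → R x y) → R u v
      wlog {u} {v} u~v R R-sym r with ℕ.<-cmp (rank u) (rank v)
      ... | tri< p _ _ = r u~v p
      ... | tri≈ _ e _ = contradiction e (ranks-differ u~v)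
      ... | tri> _ _ p = R-sym (r (~-sym u~v) p)

      Chordal : Fin n → Fin n → Point → Set
      Chordal u v = Chord (X u) (X v)

      chordal : ∀ {u v p} → rank u ℕ.< rank v → p between (vertex u , vertex v) → Chordal u v p
      chordal u<v = between⇒chord (fromℕ-mono-< u<v)

      nested : ∀ {u v x y p} → rank u ℕ.≤ rank x → rank y ℕ.≤ rank v → rank u ℕ.< rank x ⊎ rank y ℕ.< rank v →
               Chordal u v p → Chordal x y p → ∃[ w ] p ≡ vertex w
      nested {u} {v} {x} {y} u≤x y≤v strict h k
        with nested-chords (fromℕ-mono-≤ u≤x) (fromℕ-mono-≤ y≤v) (Sum.map fromℕ-mono-< fromℕ-mono-< strict) h k
      ... | inj₁ e = x , chord-left k e
      ... | inj₂ e = y , chord-right k e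

      -- Nested intervals are settled by heights, intervals without common interior can share only
      -- an end, and interleaved ones are excluded by `noncrossing`.
      ordered-cross-free : ∀ {u v x y p} → u ~ v → x ~ y → ¬ (u ≡ x × v ≡ y) →
        Chordal u v p → Chordal x y p → ∃[ w ] p ≡ vertex w
      ordered-cross-free {u} {v} {x} {y} {p} u~v x~y distinct h k with ℕ.<-cmp (rank u) (rank x)
      ... | tri≈ _ e _ with refl ← injective e with ℕ.<-cmp (rank v) (rank y)
      ...   | tri< v<y _ _ = nested ℕ.≤-refl (ℕ.<⇒≤ v<y) (inj₂ v<y) k h
      ...   | tri≈ _ e′ _  = contradiction (refl , injective e′) distinct
      ...   | tri> _ _ y<v = nested ℕ.≤-refl (ℕ.<⇒≤ y<v) (inj₂ y<v) h k
      ordered-cross-free {u} {v} {x} {y} u~v x~y distinct h k | tri< u<x _ _ with ℕ.<-cmp (rank x) (rank v) | ℕ.<-cmp (rank v) (rank y)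
      ... | tri< x<v _ _ | tri< v<y _ _ = contradiction v<y (noncrossing u~v x~y u<x x<v)
      ... | tri< x<v _ _ | tri≈ _ v≡y _ = nested (ℕ.<⇒≤ u<x) (ℕ.≤-reflexive (sym v≡y)) (inj₁ u<x) h k
      ... | tri< x<v _ _ | tri> _ _ y<v = nested (ℕ.<⇒≤ u<x) (ℕ.<⇒≤ y<v) (inj₁ u<x) h k
      ... | tri≈ _ x≡v _ | _ = v , chord-right h (ℚ.≤-antisym (Chord.upper h) (ℚ.≤-trans (fromℕ-mono-≤ (ℕ.≤-reflexive (sym x≡v))) (Chord.lower k)))
      ... | tri> _ _ v<x | _ = v , chord-right h (ℚ.≤-antisym (Chord.upper h) (ℚ.≤-trans (fromℕ-mono-≤ (ℕ.<⇒≤ v<x)) (Chord.lower k)))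
      ordered-cross-free {u} {v} {x} {y} u~v x~y distinct h k | tri> _ _ x<u with ℕ.<-cmp (rank u) (rank y) | ℕ.<-cmp (rank y) (rank v)
      ... | tri< u<y _ _ | tri< y<v _ _ = contradiction y<v (noncrossing x~y u~v x<u u<y)
      ... | tri< u<y _ _ | tri≈ _ y≡v _ = nested (ℕ.<⇒≤ x<u) (ℕ.≤-reflexive (sym y≡v)) (inj₁ x<u) k h
      ... | tri< u<y _ _ | tri> _ _ v<y = nested (ℕ.<⇒≤ x<u) (ℕ.<⇒≤ v<y) (inj₁ x<u) k h
      ... | tri≈ _ u≡y _ | _ = y , chord-right k (ℚ.≤-antisym (Chord.upper k) (ℚ.≤-trans (fromℕ-mono-≤ (ℕ.≤-reflexive (sym u≡y))) (Chord.lower h)))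
      ... | tri> _ _ y<u | _ = y , chord-right k (ℚ.≤-antisym (Chord.upper k) (ℚ.≤-trans (fromℕ-mono-≤ (ℕ.<⇒≤ y<u)) (Chord.lower h)))

      sameEdge-flipˡ : ∀ {u v x y : Fin n} → SameEdge v u x y → SameEdge u v x y
      sameEdge-flipˡ (inj₁ (p , q)) = inj₂ (q , p)
      sameEdge-flipˡ (inj₂ (p , q)) = inj₁ (q , p)

      sameEdge-flipʳ : ∀ {u v x y : Fin n} → SameEdge u v y x → SameEdge u v x y
      sameEdge-flipʳ (inj₁ (p , q)) = inj₂ (p , q)
      sameEdge-flipʳ (inj₂ (p , q)) = inj₁ (p , q)

      cross-free : ∀ u v x y → u ~ v → x ~ y → ¬ SameEdge u v x y → ∀ p →
        p between (vertex u , vertex v) → p between (vertex x , vertex y) → ∃[ w ] p ≡ vertex w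
      cross-free u v x y u~v x~y distinct p = wlog u~v
        (λ u v → ¬ SameEdge u v x y → p between (vertex u , vertex v) → p between (vertex x , vertex y) → ∃[ w ] p ≡ vertex w)
        (λ f ¬same on → f (λ same → ¬same (sameEdge-flipˡ same)) (between-swap on))
        (λ {u} {v} u~v u<v → wlog x~y
          (λ x y → ¬ SameEdge u v x y → p between (vertex u , vertex v) → p between (vertex x , vertex y) → ∃[ w ] p ≡ vertex w)
          (λ f ¬same on on′ → f (λ same → ¬same (sameEdge-flipʳ same)) on (between-swap on′))
          (λ x~y x<y ¬same on on′ → ordered-cross-free u~v x~y (λ e → ¬same (inj₁ e)) (chordal u<v on) (chordal x<y on′)))
        distinct

      vertex-on-chord : ∀ u v w → u ~ v → vertex w between (vertex u , vertex v) → w ≡ u ⊎ w ≡ v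
      vertex-on-chord u v w u~v = wlog u~v
        (λ u v → vertex w between (vertex u , vertex v) → w ≡ u ⊎ w ≡ v)
        (λ f on → Sum.swap (f (between-swap on)))
        (λ u~v u<v on → Sum.map (injective ∘ fromℕ-injective) (injective ∘ fromℕ-injective) (chord-vertex (chordal u<v on)))

      drawing : PlaneDrawing G
      drawing = record
        { pos              = vertex
        ; bends            = λ _ _ → []
        ; pos-injective    = λ u v e → injective (fromℕ-injective (cong proj₁ e))
        ; bends-sym        = λ _ _ _ → refl
        ; curve-arc        = λ _ _ _ → (λ _ _ on → on) , tt
        ; vertex-free      = λ u v w u~v on → vertex-on-chord u v w u~v (curve⇒between on)
        ; edges-cross-free = λ u v x y u~v x~y distinct p on on′ →
            cross-free u v x y u~v x~y distinct p (curve⇒between on) (curve⇒between on′)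
        }

      open PlaneDrawing drawing using (Drawn; OnOuterFace)

      drawn-bounds : ∀ p → Drawn p → proj₁ p < fromℕ size × proj₁ p * proj₁ p ≤ℚ proj₂ p
      drawn-bounds _ (inj₁ (w , refl)) = fromℕ-mono-< (rank<size w) , ℚ.≤-refl
      drawn-bounds p (inj₂ (u , v , u~v , on)) = wlog u~v
        (λ u v → p between (vertex u , vertex v) → proj₁ p < fromℕ size × proj₁ p * proj₁ p ≤ℚ proj₂ p)
        (λ f on → f (between-swap on))
        (λ {u} {v} u~v u<v on → let h = chordal u<v on in
          ℚ.≤-<-trans (Chord.upper h) (fromℕ-mono-< (rank<size v)) , chord-above h)
        (curve⇒between on)

      -- Leave v vertically to below the parabola, then go right.
      outer : ∀ v → OnOuterFace v
      outer v = (fromℕ size , - 1ℚ) , (X v , - 1ℚ) ∷ [] , (λ p drawn → proj₁ (drawn-bounds p drawn)) , leaves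
        where
        x = X v
        below : ∀ s {y} → y ≡ - 1ℚ → ¬ (s * s ≤ℚ y)
        below s refl s²≤-1 = ℚ.<-irrefl refl (ℚ.<-≤-trans (ℚ.<-≤-trans (ℚ.neg-antimono-< (ℚ.positive⁻¹ 1ℚ)) (0≤x*x s)) s²≤-1)
        flat : ∀ t → (1ℚ - t) * - 1ℚ + t * - 1ℚ ≡ - 1ℚ
        flat = solve-∀ ringℚ
        -- At parameter t the vertical leg is t(x² + 1) below the parabola, whereas the whole
        -- drawing lies on or above it.
        drop : ∀ x t → ((1ℚ - t) * (x * x) + t * - 1ℚ) - ((1ℚ - t) * x + t * x) * ((1ℚ - t) * x + t * x) ≡ - (t * (x * x + 1ℚ))
        drop = solve-∀ ringℚ
        start : ∀ x y → (1ℚ - 0ℚ) * x + 0ℚ * y ≡ x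
        start = solve-∀ ringℚ
        leaves : ∀ p → OnCurve (vertex v ∷ (x , - 1ℚ) ∷ (fromℕ size , - 1ℚ) ∷ []) p → Drawn p → p ≡ vertex v
        leaves (_ , _) (inj₁ (t , 0≤t , t≤1 , refl , refl)) drawn with split-≤ 0≤t
        ... | inj₂ refl = cong₂ _,_ (start x x) (start (x * x) (- 1ℚ))
        ... | inj₁ 0<t = ⊥-elim (ℚ.<-irrefl refl (ℚ.≤-<-trans (0≤- (proj₂ (drawn-bounds _ drawn)))
          (subst (_< 0ℚ) (sym (drop x t)) (ℚ.neg-antimono-< (0<* 0<t (ℚ.+-mono-≤-< (0≤x*x x) (ℚ.positive⁻¹ 1ℚ)))))))
        leaves (s , _) (inj₂ (inj₁ (t , _ , _ , _ , e))) drawn = contradiction (proj₂ (drawn-bounds _ drawn)) (below s (trans e (flat t)))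
        leaves _ (inj₂ (inj₂ refl)) drawn = contradiction (proj₂ (drawn-bounds _ drawn)) (below (fromℕ size) refl)

    noncrossing⇒outerplanar : Outerplanar G
    noncrossing⇒outerplanar = drawing , outer

open ParabolaDrawing

-- Triangulated polygons, their 3-colourings and the Sudoku number.

module Triangulation where

  open import Data.Nat using (_+_; _∸_; _<_)

  greatest : ∀ {n} (f : Fin n → ℕ) {P : Pred (Fin n) 0ℓ} {b} → (∀ x → f x ≤ b) → Decidable P → ∃ P →
             ∃[ m ] (P m × (∀ y → P y → f y ≤ f m))
  greatest f {b = b} f≤b P? p with m , pm , minimal ← least (λ x → b ∸ f x) P? p =
    m , pm , λ y py → ℕ.≮⇒≥ λ fm<fy → ℕ.<⇒≱ (ℕ.∸-monoʳ-< fm<fy (f≤b y)) (minimal y py)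

  -- The colour x with a + b + x ≡ 0 (mod 3); in particular third a a ≡ a.
  third : Fin 3 → Fin 3 → Fin 3
  third zero zero = zero
  third zero (suc zero) = suc (suc zero)
  third zero (suc (suc zero)) = suc zero
  third (suc zero) zero = suc (suc zero)
  third (suc zero) (suc zero) = suc zero
  third (suc zero) (suc (suc zero)) = zero
  third (suc (suc zero)) zero = suc zero
  third (suc (suc zero)) (suc zero) = zero
  third (suc (suc zero)) (suc (suc zero)) = suc (suc zero)

  third-distinct : ∀ a b → a ≢ b → third a b ≢ a × third a b ≢ b
  third-distinct = from-yes (Fin.all? λ a → Fin.all? λ b → ¬? (a Fin.≟ b) →-dec (¬? (third a b Fin.≟ a) ×-dec ¬? (third a b Fin.≟ b)))

  third-unique : ∀ a b x → a ≢ b → x ≢ a → x ≢ b → x ≡ third a b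
  third-unique = from-yes (Fin.all? λ a → Fin.all? λ b → Fin.all? λ x →
    ¬? (a Fin.≟ b) →-dec (¬? (x Fin.≟ a) →-dec (¬? (x Fin.≟ b) →-dec (x Fin.≟ third a b))))

  third-idempotent : ∀ a → third a a ≡ a
  third-idempotent = from-yes (Fin.all? λ a → third a a Fin.≟ a)

  third-involutive : ∀ a b → third a (third a b) ≡ b
  third-involutive = from-yes (Fin.all? λ a → Fin.all? λ b → third a (third a b) Fin.≟ b)

  third-fixed : ∀ a b → third a b ≡ b → a ≡ b
  third-fixed = from-yes (Fin.all? λ a → Fin.all? λ b → (third a b Fin.≟ b) →-dec (a Fin.≟ b))

  ∣pair∣≡2 : ∀ {n} {i j : Fin n} → i ≢ j → ∣ ⁅ i ⁆ ∪ ⁅ j ⁆ ∣ ≡ 2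
  ∣pair∣≡2 {i = zero}  {zero}  i≢j = contradiction refl i≢j
  ∣pair∣≡2 {i = zero}  {suc j} _   = cong suc (trans (cong ∣_∣ (Subset.∪-identityˡ ⁅ j ⁆)) (Subset.∣⁅x⁆∣≡1 j))
  ∣pair∣≡2 {i = suc i} {zero}  _   = cong suc (trans (cong ∣_∣ (Subset.∪-identityʳ ⁅ i ⁆)) (Subset.∣⁅x⁆∣≡1 i))
  ∣pair∣≡2 {i = suc i} {suc j} i≢j = ∣pair∣≡2 (i≢j ∘ cong suc)

  2≤∣S∣ : ∀ {n} {S : Subset n} {i j} → i ∈ˢ S → j ∈ˢ S → i ≢ j → 2 ≤ ∣ S ∣
  2≤∣S∣ {S = S} {i} {j} i∈S j∈S i≢j = subst (_≤ ∣ S ∣) (∣pair∣≡2 i≢j) (Subset.p⊆q⇒∣p∣≤∣q∣ pair⊆S)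
    where
    pair⊆S : ∀ {x} → x ∈ˢ ⁅ i ⁆ ∪ ⁅ j ⁆ → x ∈ˢ S
    pair⊆S {x} x∈ with Subset.x∈p∪q⁻ ⁅ i ⁆ ⁅ j ⁆ x∈
    ... | inj₁ x∈i = subst (_∈ˢ S) (sym (Subset.x∈⁅y⁆⇒x≡y i x∈i)) i∈S
    ... | inj₂ x∈j = subst (_∈ˢ S) (sym (Subset.x∈⁅y⁆⇒x≡y j x∈j)) j∈S

  at-most-one-or-2≤ : ∀ {n} (S : Subset n) → Fin n → 2 ≤ ∣ S ∣ ⊎ ∃[ s ] (∀ x → x ∈ˢ S → x ≡ s)
  at-most-one-or-2≤ S v with Fin.any? (λ s → s Subset.∈? S)
  -- For empty `S` the given vertex v stands in for the single element.
  ... | no none = inj₂ (v , λ x x∈S → contradiction (x , x∈S) none)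
  ... | yes (s , s∈S) with Fin.any? (λ x → (x Subset.∈? S) ×-dec ¬? (x Fin.≟ s))
  ...   | yes (x , x∈S , x≢s) = inj₁ (2≤∣S∣ x∈S s∈S x≢s)
  ...   | no none = inj₂ (s , λ x x∈S → decidable-stable (x Fin.≟ s) λ x≢s → none (x , x∈S , x≢s))

  three-distinct : ∀ {k} (a b c : Fin k) → a ≢ b → a ≢ c → b ≢ c → 3 ≤ k
  three-distinct {k} a b c a≢b a≢c b≢c = ℕ.≮⇒≥ λ k<3 → clash (Fin.pigeonhole k<3 f)
    where
    f : Fin 3 → Fin k
    f zero             = a
    f (suc zero)       = b
    f (suc (suc zero)) = c
    clash : ¬ (∃[ i ] ∃[ j ] (toℕ i < toℕ j × f i ≡ f j))
    clash (zero , suc zero , _ , e)             = a≢b e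
    clash (zero , suc (suc zero) , _ , e)       = a≢c e
    clash (suc zero , suc (suc zero) , _ , e)   = b≢c e
    clash (suc zero , suc zero , s≤s () , _)
    clash (suc (suc zero) , suc zero , s≤s () , _)
    clash (suc (suc zero) , suc (suc zero) , s≤s (s≤s ()) , _)

  module _ {n} {G : Graph n} (ord : NoncrossingOrder G) where
    open Graph G
    open NoncrossingOrder ord

    private V = Fin n

    Inside : V → V → V → Set
    Inside i j x = rank i < rank x × rank x < rank j

    inside? : ∀ i j → Decidable (Inside i j)
    inside? i j x = (rank i ℕ.<? rank x) ×-dec (rank x ℕ.<? rank j)

    -- A triangulated polygon seen from its base edge ij: m is the apex of the triangle on the base,
    -- and the other two sides of that triangle are the bases of the remaining pieces. A leaf is an
    -- edge between consecutive ranks.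
    data Triangulated : V → V → Set where
      leaf : ∀ {i j} → i ~ j → rank i < rank j → (∀ x → ¬ Inside i j x) → Triangulated i j
      node : ∀ {i j} m → i ~ j → Inside i j m → Triangulated i m → Triangulated m j → Triangulated i j

    base : ∀ {i j} → Triangulated i j → i ~ j
    base (leaf e _ _)     = e
    base (node _ e _ _ _) = e

    Within : V → V → V → Set
    Within i j x = rank i ≤ rank x × rank x ≤ rank j

    end-or-inside : ∀ {i j x} → Within i j x → x ≡ i ⊎ x ≡ j ⊎ Inside i j x
    end-or-inside (i≤x , x≤j) with ℕ.m≤n⇒m<n∨m≡n i≤x | ℕ.m≤n⇒m<n∨m≡n x≤j
    ... | inj₂ e   | _        = inj₁ (injective (sym e))
    ... | inj₁ _   | inj₂ e   = inj₂ (inj₁ (injective e))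
    ... | inj₁ i<x | inj₁ x<j = inj₂ (inj₂ (i<x , x<j))

    connected-to-base : ∀ {i j} → Triangulated i j → ∀ {x} → Within i j x → Star _~_ i x
    connected-to-base (leaf i~j _ none) x∈ with end-or-inside x∈
    ... | inj₁ refl        = ε
    ... | inj₂ (inj₁ refl) = i~j ◅ ε
    ... | inj₂ (inj₂ h)    = contradiction h (none _)
    connected-to-base (node m i~j (i<m , m<j) l r) {x} (i≤x , x≤j) with ℕ.≤-total (rank x) (rank m)
    ... | inj₁ x≤m = connected-to-base l (i≤x , x≤m)
    ... | inj₂ m≤x = base l ◅ connected-to-base r (m≤x , x≤j)

    -- The apex is adjacent to both ends of the base, so only the third colour is left for it; this
    -- fixes the colours on the bases of both pieces.
    unique-extension : ∀ {i j} → Triangulated i j → ∀ {c c′ : V → Fin 3} → IsProper G c → IsProper G c′ →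
                       c′ i ≡ c i → c′ j ≡ c j → ∀ {x} → Within i j x → c′ x ≡ c x
    unique-extension (leaf i~j _ none) pc pc′ ei ej x∈ with end-or-inside x∈
    ... | inj₁ refl        = ei
    ... | inj₂ (inj₁ refl) = ej
    ... | inj₂ (inj₂ h)    = contradiction h (none _)
    unique-extension {i} {j} (node m i~j (i<m , m<j) l r) {c} {c′} pc pc′ ei ej {x} (i≤x , x≤j) =
      [ (λ x≤m → unique-extension l pc pc′ ei em (i≤x , x≤m)) , (λ m≤x → unique-extension r pc pc′ em ej (m≤x , x≤j)) ]′
        (ℕ.≤-total (rank x) (rank m))
      where
      em : c′ m ≡ c m
      em = trans (third-unique (c i) (c j) (c′ m) (pc i j i~j)
                   (λ e → pc′ i m (base l) (trans ei (sym e))) (λ e → pc′ m j (base r) (trans e (sym ej))))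
           (sym (third-unique (c i) (c j) (c m) (pc i j i~j) (pc i m (base l) ∘ sym) (pc m j (base r))))

    ProperWithin : V → V → (V → Fin 3) → Set
    ProperWithin i j c = ∀ {x y} → Within i j x → Within i j y → rank x < rank y → x ~ y → c x ≢ c y

    -- The apex gets the third colour and both pieces are coloured independently. The union is
    -- proper because the base is the only edge that passes over the apex m: any other would cross
    -- im or mj.
    three-colouring : ∀ {i j} → Triangulated i j → ∀ {a b} → a ≢ b →
                      ∃[ c ] (c i ≡ a × c j ≡ b × ProperWithin i j c)
    three-colouring {i} {j} (leaf i~j i<j none) {a} {b} a≢b = c , at-i , at-j , proper
      where
      c : V → Fin 3
      c x with x Fin.≟ i
      ... | yes _ = a
      ... | no _  = b
      at-i : c i ≡ a
      at-i with i Fin.≟ i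
      ... | yes _ = refl
      ... | no ne = contradiction refl ne
      at-j : c j ≡ b
      at-j with j Fin.≟ i
      ... | yes refl = contradiction i<j (ℕ.<-irrefl refl)
      ... | no _     = refl
      proper : ProperWithin i j c
      proper x∈ y∈ x<y x~y with end-or-inside x∈ | end-or-inside y∈
      ... | inj₁ refl | inj₁ refl = contradiction x<y (ℕ.<-irrefl refl)
      ... | inj₁ refl | inj₂ (inj₁ refl) = λ e → a≢b (trans (sym at-i) (trans e at-j))
      ... | inj₂ (inj₁ refl) | _ = contradiction (proj₂ y∈) (ℕ.<⇒≱ x<y)
      ... | inj₂ (inj₂ h) | _ = contradiction h (none _)
      ... | _ | inj₂ (inj₂ h) = contradiction h (none _)
    three-colouring {i} {j} (node m i~j (i<m , m<j) l r) {a} {b} a≢b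
      with t≢a , t≢b ← third-distinct a b a≢b
      with cl , cli , clm , pl ← three-colouring l (t≢a ∘ sym)
      with cr , crm , crj , pr ← three-colouring r t≢b = c , trans (c-left (ℕ.<⇒≤ i<m)) cli , trans (c-right (ℕ.<⇒≤ m<j)) crj , proper
      where
      c : V → Fin 3
      c x with rank x ℕ.≤? rank m
      ... | yes _ = cl x
      ... | no _  = cr x
      c-left : ∀ {x} → rank x ≤ rank m → c x ≡ cl x
      c-left {x} x≤m with rank x ℕ.≤? rank m
      ... | yes _  = refl
      ... | no x≰m = contradiction x≤m x≰m
      c-right : ∀ {x} → rank m ≤ rank x → c x ≡ cr x
      c-right {x} m≤x with rank x ℕ.≤? rank m
      ... | no _    = refl
      -- The only vertex common to both pieces is m, where the two colourings agree.
      ... | yes x≤m with refl ← injective (ℕ.≤-antisym x≤m m≤x) = trans clm (sym crm)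
      proper : ProperWithin i j c
      proper {x} {y} (i≤x , x≤j) (i≤y , y≤j) x<y x~y with ℕ.≤-<-connex (rank y) (rank m) | ℕ.≤-<-connex (rank m) (rank x)
      ... | inj₁ y≤m | _ = subst₂ _≢_ (sym (c-left x≤m)) (sym (c-left y≤m)) (pl (i≤x , x≤m) (i≤y , y≤m) x<y x~y)
        where x≤m = ℕ.≤-trans (ℕ.<⇒≤ x<y) y≤m
      ... | _ | inj₁ m≤x = subst₂ _≢_ (sym (c-right m≤x)) (sym (c-right m≤y)) (pr (m≤x , x≤j) (m≤y , y≤j) x<y x~y)
        where m≤y = ℕ.≤-trans m≤x (ℕ.<⇒≤ x<y)
      ... | inj₂ m<y | inj₂ x<m with ℕ.m≤n⇒m<n∨m≡n i≤x | ℕ.m≤n⇒m<n∨m≡n y≤j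
      ...   | inj₁ i<x | _ = contradiction m<y (noncrossing (base l) x~y i<x x<m)
      ...   | _ | inj₁ y<j = contradiction y<j (noncrossing x~y (base r) x<m m<y)
      ...   | inj₂ ei | inj₂ ej with refl ← injective ei with refl ← injective ej =
        λ e → a≢b (trans (sym (trans (c-left (ℕ.<⇒≤ i<m)) cli)) (trans e (trans (c-right (ℕ.<⇒≤ m<j)) crj)))

    -- The triangle on i, m and j forces three colours, and the ends of the base serve as the
    -- initially coloured set.
    sudoku-number : ∀ {i j} m → Inside i j m → Triangulated i m → Triangulated m j → i ~ j →
                    (∀ x → Within i j x) → HasSudokuNumber G 2
    sudoku-number {i} {j} m m∈ l r i~j all = record
      { connected = λ u v → reverse ~-sym (connected-to-base T (all u)) ◅◅ connected-to-base T (all v)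
      ; χ         = 3
      ; χ-correct = (colour , colour-proper) , λ k (c , proper) →
          three-distinct (c i) (c m) (c j) (proper i m (base l)) (proper i j i~j) (proper m j (base r))
      ; χ≥2       = s≤s (s≤s z≤n)
      ; attained  = ⁅ i ⁆ ∪ ⁅ j ⁆ , ∣pair∣≡2 i≢j ,
          record { color = λ v _ → colour v ; proper = λ u v _ _ → colour-proper u v } ,
          colour , (colour-proper , λ _ _ → refl) , λ c′ (proper′ , agree) v →
            unique-extension T colour-proper proper′
              (agree i (Subset.x∈p∪q⁺ (inj₁ (Subset.x∈⁅x⁆ i)))) (agree j (Subset.x∈p∪q⁺ (inj₂ (Subset.x∈⁅x⁆ j)))) (all v)
      ; minimal   = minimal
      }
      where
      T : Triangulated i j
      T = node m i~j m∈ l r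
      i≢j : i ≢ j
      i≢j refl = ~-irrefl i~j
      colouring = three-colouring T {zero} {suc zero} (λ ())
      colour = proj₁ colouring
      colour-proper : IsProper G colour
      colour-proper x y x~y with ℕ.<-cmp (rank x) (rank y)
      ... | tri< x<y _ _ = proj₂ (proj₂ (proj₂ colouring)) (all x) (all y) x<y x~y
      ... | tri≈ _ e _   = λ _ → ~-irrefl (subst (_~ y) (injective e) x~y)
      ... | tri> _ _ y<x = proj₂ (proj₂ (proj₂ colouring)) (all y) (all x) y<x (~-sym x~y) ∘ sym
      -- Reflecting the colours at the colour of the only vertex of S fixes no
      -- other colour.
      minimal : ∀ S → AdmitsSudokuColoring G 3 S → 2 ≤ ∣ S ∣
      minimal S (_ , c , (proper , agree) , unique) with at-most-one-or-2≤ S i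
      ... | inj₁ h = h
      ... | inj₂ (s , only) = contradiction (trans (sym (fixed i)) (fixed j)) (proper i j i~j)
        where
        reflect : V → Fin 3
        reflect x = third (c s) (c x)
        reflect-proper : IsProper G reflect
        reflect-proper x y x~y e = proper x y x~y
          (trans (sym (third-involutive (c s) (c x))) (trans (cong (third (c s)) e) (third-involutive (c s) (c y))))
        reflect-agrees : ∀ x → x ∈ˢ S → reflect x ≡ c x
        reflect-agrees x x∈S with refl ← only x x∈S = third-idempotent (c x)
        fixed : ∀ x → c s ≡ c x
        fixed x = third-fixed (c s) (c x) (unique reflect (reflect-proper , λ v v∈S → trans (reflect-agrees v v∈S) (agree v v∈S)) x)

    -- Maximality relative to the fixed order. The premise says that no edge would cross a chord uv,
    -- since a crossing edge has one end strictly inside and the other strictly outside.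
    Saturated : Set
    Saturated = ∀ {u v} → rank u < rank v →
                (∀ {x y} → x ~ y → Inside u v x → ¬ (rank y < rank u) × ¬ (rank v < rank y)) → u ~ v

    module _ (saturated : Saturated) where

      -- The apex m is the last neighbour of i inside the base, and k bounds the rank difference.
      -- Then m ~ j by saturation: an edge leaving the stretch from m to j would cross ij or im, or
      -- end in i and make its other end a later neighbour of i.
      triangulated : ∀ k {i j} → rank j < k + rank i → i ~ j → rank i < rank j → Triangulated i j
      triangulated zero    {i} {j} j<i   i~j i<j = contradiction j<i (ℕ.<-asym i<j)
      triangulated (suc k) {i} {j} (s≤s j≤k+i) i~j i<j with Fin.any? (inside? i j)
      ... | no none = leaf i~j i<j λ x x∈ → none (x , x∈)
      ... | yes some
        with f , (i<f , f<j) , f-first ← least rank (inside? i j) some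
        with m , ((i<m , m<j) , i~m) , m-last ← greatest rank (λ x → ℕ.<⇒≤ (rank<size x)) (λ x → inside? i j x ×-dec (i ~? x))
               -- A neighbour of i inside exists: nothing lies between i and the first inner vertex
               -- f, so saturation joins them.
               (f , (i<f , f<j) , saturated i<f λ _ (i<x , x<f) → contradiction (f-first _ (i<x , ℕ.<-trans x<f f<j)) (ℕ.<⇒≱ x<f)) =
        node m i~j (i<m , m<j)
          (triangulated k (ℕ.<-≤-trans m<j j≤k+i) i~m i<m)
          (triangulated k (ℕ.≤-<-trans j≤k+i (ℕ.+-monoʳ-< k i<m)) m~j m<j)
        where
        m~j : m ~ j
        m~j = saturated m<j λ {x} {y} x~y (m<x , x<j) →
          (λ y<m → before-m x~y m<x x<j y<m) ,
          λ j<y → noncrossing i~j x~y (ℕ.<-trans i<m m<x) x<j j<y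
          where
          before-m : ∀ {x y} → x ~ y → rank m < rank x → rank x < rank j → ¬ (rank y < rank m)
          before-m {x} {y} x~y m<x x<j y<m with ℕ.<-cmp (rank y) (rank i)
          ... | tri< y<i _ _ = noncrossing (~-sym x~y) i~j y<i (ℕ.<-trans i<m m<x) x<j
          ... | tri> _ _ i<y = noncrossing i~m (~-sym x~y) i<y y<m m<x
          ... | tri≈ _ e _ with refl ← injective e =
            contradiction (m-last x ((ℕ.<-trans i<m m<x , x<j) , ~-sym x~y)) (ℕ.<⇒≱ m<x)

      saturated⇒sudoku-number : 3 ≤ n → HasSudokuNumber G 2
      saturated⇒sudoku-number 3≤n
        with i , _ , i-first ← least rank {λ _ → ⊤} (λ _ → yes tt) (fromℕ< (ℕ.<-≤-trans (s≤s z≤n) 3≤n) , tt)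
        with j , _ , j-last ← greatest rank {λ _ → ⊤} (λ x → ℕ.<⇒≤ (rank<size x)) (λ _ → yes tt) (i , tt)
        with Fin.any? (inside? i j)
      -- Without a vertex between i and j, every vertex would be one of these two, against the order
      -- being at least 3.
      ... | no none = contradiction (Fin.pigeonhole 3≤n side) λ (x , y , x<y , e) →
              Fin.<⇒≢ x<y (side-injective x y e)
        where
        end-vertex : ∀ x → x ≡ i ⊎ x ≡ j
        end-vertex x with end-or-inside (i-first x tt , j-last x tt)
        ... | inj₁ e        = inj₁ e
        ... | inj₂ (inj₁ e) = inj₂ e
        ... | inj₂ (inj₂ h) = contradiction (x , h) none
        side : Fin n → Fin 2
        side x with end-vertex x
        ... | inj₁ _ = zero
        ... | inj₂ _ = suc zero
        side-injective : ∀ x y → side x ≡ side y → x ≡ y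
        side-injective x y e with end-vertex x | end-vertex y
        ... | inj₁ p | inj₁ q = trans p (sym q)
        ... | inj₂ p | inj₂ q = trans p (sym q)
        side-injective x y () | inj₁ _ | inj₂ _
        side-injective x y () | inj₂ _ | inj₁ _
      ... | yes (x , i<x , x<j)
        with triangulated (suc (rank j)) {i} {j} (ℕ.m≤m+n _ (rank i)) i~j (ℕ.<-trans i<x x<j)
        where
        i~j : i ~ j
        -- No vertex ranks below i or above j, so no edge can cross this chord.
        i~j = saturated (ℕ.<-trans i<x x<j) λ {_} {y} _ _ → ℕ.≤⇒≯ (i-first y tt) , ℕ.≤⇒≯ (j-last y tt)
      ...   | leaf _ _ none = contradiction (i<x , x<j) (none x)
      ...   | node m i~j m∈ l r = sudoku-number m m∈ l r i~j λ y → i-first y tt , j-last y tt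

open Triangulation

-- Maximal outerplanar graphs and fans are saturated.

module Outerplanarity where

  open import Data.Nat using (_<_)

  outerplanar⇒noncrossing : ∀ {n} {G : Graph n} → Outerplanar G → NoncrossingOrder G
  outerplanar⇒noncrossing (D , outer) =
    noncrossing-order (drawing-isTournament D outer) (drawing-evenlyCrossing D outer)

  module _ {n} {G : Graph n} (ord : NoncrossingOrder G) where
    open Graph G
    open NoncrossingOrder ord

    addEdge-order : ∀ {u v} (u≢v : u ≢ v) → rank u < rank v →
                    (∀ {x y} → x ~ y → Inside ord u v x → ¬ (rank y < rank u) × ¬ (rank v < rank y)) →
                    NoncrossingOrder (addEdge G u v u≢v)
    addEdge-order {u} {v} u≢v u<v free = record
      { rank = rank ; size = size ; rank<size = rank<size ; injective = injective ; noncrossing = cross }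
      where
      cross : ∀ {x y z w} → x ~ y ⊎ SameEdge x y u v → z ~ w ⊎ SameEdge z w u v →
              rank x < rank z → rank z < rank y → ¬ (rank y < rank w)
      cross (inj₁ x~y) (inj₁ z~w) = noncrossing x~y z~w
      cross (inj₁ x~y) (inj₂ (inj₁ (refl , refl))) x<u u<y y<v = proj₁ (free (~-sym x~y) (u<y , y<v)) x<u
      cross (inj₁ x~y) (inj₂ (inj₂ (refl , refl))) x<v v<y y<u = ℕ.<-asym u<v (ℕ.<-trans v<y y<u)
      cross (inj₂ (inj₁ (refl , refl))) (inj₁ z~w) u<z z<v v<w = proj₂ (free z~w (u<z , z<v)) v<w
      cross (inj₂ (inj₂ (refl , refl))) (inj₁ z~w) v<z z<u _ = ℕ.<-asym u<v (ℕ.<-trans v<z z<u)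
      cross (inj₂ (inj₁ (refl , refl))) (inj₂ (inj₁ (refl , refl))) u<u _ _ = ℕ.<-irrefl refl u<u
      cross (inj₂ (inj₁ (refl , refl))) (inj₂ (inj₂ (refl , refl))) _ v<v _ = ℕ.<-irrefl refl v<v
      cross (inj₂ (inj₂ (refl , refl))) (inj₂ (inj₁ (refl , refl))) _ u<u _ = ℕ.<-irrefl refl u<u
      cross (inj₂ (inj₂ (refl , refl))) (inj₂ (inj₂ (refl , refl))) v<v _ _ = ℕ.<-irrefl refl v<v

    -- The same ranks remain a noncrossing order after uv is added, so the parabola drawing would
    -- make the larger graph outerplanar.
    maximal⇒saturated : (∀ u v (u≢v : u ≢ v) → ¬ (u ~ v) → ¬ Outerplanar (addEdge G u v u≢v)) → Saturated ord
    maximal⇒saturated maximal {u} {v} u<v free with u ~? v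
    ... | yes u~v = u~v
    ... | no u≁v  = contradiction (noncrossing⇒outerplanar (addEdge-order u≢v u<v free)) (maximal u v u≢v u≁v)
      where
      u≢v : u ≢ v
      u≢v refl = ℕ.<-irrefl refl u<v

  maximalOuterplanar⇒sudoku-number : ∀ n (G : Graph n) → 3 ≤ n → MaximalOuterplanar G → HasSudokuNumber G 2
  maximalOuterplanar⇒sudoku-number n G 3≤n (outerplanar , maximal) =
    saturated⇒sudoku-number ord (maximal⇒saturated ord maximal) 3≤n
    where ord = outerplanar⇒noncrossing outerplanar

  -- The centre comes first, followed by the path. In a crossing, the edge that starts later avoids
  -- the centre, so it joins consecutive ranks and leaves no room for an end of the other edge.
  fan-order : ∀ n → NoncrossingOrder (fan n)
  fan-order n = record
    { rank = toℕ ; size = suc n ; rank<size = Fin.toℕ<n ; injective = Fin.toℕ-injective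
    ; noncrossing = λ {x} {y} {z} {w} _ → cross {x} {y} {z} {w} }
    where
    cross : ∀ {x y z w} → Graph._~_ (fan n) z w → toℕ x < toℕ z → toℕ z < toℕ y → ¬ (toℕ y < toℕ w)
    cross {z = suc i} {suc j} (inj₁ e) _ i<y y<j = ℕ.<⇒≱ i<y (ℕ.≤-pred (ℕ.≤-trans y<j (ℕ.≤-reflexive (cong suc (sym e)))))
    cross {z = suc i} {suc j} (inj₂ e) _ i<y y<j =
      ℕ.<-asym (ℕ.<-trans i<y y<j) (s≤s (ℕ.≤-reflexive e))

  -- Between two path vertices that are not consecutive lies the successor of the first, whose edge
  -- to the centre crosses the chord.
  fan-saturated : ∀ n → Saturated (fan-order n)
  fan-saturated n {zero}  {suc j} _ _ = tt
  fan-saturated n {suc i} {suc j} (s≤s i<j) free with suc (toℕ i) ℕ.≟ toℕ j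
  ... | yes e = inj₁ e
  ... | no ne = contradiction (s≤s z≤n) (proj₁ (free {suc next} {zero} tt
          (subst (suc (toℕ i) <_) (sym next≡) ℕ.≤-refl , subst (_< suc (toℕ j)) (sym next≡) (s≤s i+1<j))))
    where
    i+1<j : suc (toℕ i) < toℕ j
    i+1<j = ℕ.≤∧≢⇒< i<j ne
    next : Fin n
    next = fromℕ< (ℕ.<-trans i+1<j (Fin.toℕ<n j))
    next≡ : suc (toℕ next) ≡ suc (suc (toℕ i))
    next≡ = cong suc (Fin.toℕ-fromℕ< _)

  fan-sudoku-number : ∀ n → 2 ≤ n → HasSudokuNumber (fan n) 2
  fan-sudoku-number n 2≤n = saturated⇒sudoku-number (fan-order n) (fan-saturated n) (s≤s 2≤n)

open Outerplanarity

corollary3p13 : (∀ (n : ℕ) → 2 ≤ n → HasSudokuNumber (fan n) 2)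
    × (∀ (n : ℕ) (G : Graph n) → 3 ≤ n → MaximalOuterplanar G → HasSudokuNumber G 2)
corollary3p13 = fan-sudoku-number , maximalOuterplanar⇒sudoku-number
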